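{- The map $$\pi\colon I_{R_3}\setminus\partial\mathcal{M}(f_3^\star)\to F_{\mathbb{A}}^{\mathbb{N}}\setminus\big\{\underline\xi\in F_{\mathbb{A}}^{\mathbb{N}}:\ \exists\,n\in\mathbb{Z}_{\ge0}:\ \tau^n(\underline\xi)=\pm\underline{r}_3\big\},$$ given by $\pi(x)=\underline\xi=(\xi_i)_{i\in\mathbb{N}}$ if $(f_3^\star)^{i-1}(x)\in J^\star_{\xi_i}$ for all $i\in\mathbb{N}$, is bijective, and $\pi\circ f_3^\star=\tau\circ\pi$. Its inverse can be defined on the entire set $F_{\mathbb{A}}^{\mathbb{N}}$, as the map $\pi^{ -1}\colon F_{\mathbb{A}}^{\mathbb{N}}\to I_{R_3}$ given by $\pi^{ -1}(\underline\xi)=x$, with $x$ the unique point of $I_{R_3}$ with $x\in J^\star_{\xi_1}\cap\bigcap_{l=1}^\infty(f^\star_{\xi_l}\circ\cdots\circ f^\star_{\xi_1})^{ -1}J^\star_{\xi_{l+1}}$.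
   Context: Here $q=3$ and $\lambda_3=1$. Let $R_3=\frac{\sqrt5-1}{2}$, $r_3=R_3-1=\frac{\sqrt5-3}{2}$, and $I_{R_3}=[-R_3,R_3]$. For $x\ge0$ let $\langle x\rangle^\star$ be the integer $n$ with $n+r_3\le x<n+R_3$, and for $x<0$ put $\langle x\rangle^\star=-\langle-x\rangle^\star$. The map $f_3^\star\colon I_{R_3}\to I_{R_3}$ is $f_3^\star(y)=-\frac1y-\langle-\frac1y\rangle^\star$ for $y\ne0$, $f_3^\star(0)=0$. For $m\ge2$ let $J_m^\star=\big[\frac{ -1}{r_3+m},\frac{ -1}{r_3+m+1}\big]$ and $J_{ -m}^\star=-J_m^\star$. For $m\in\mathbb{Z}\setminus\{0,\pm1\}$, $f_m^\star$ denotes the branch of $f_3^\star$ on $J_m^\star$, i.e. $f_m^\star(x)=-\frac1x-m$ for $x\in J_m^\star$. The condition $x\in J^\star_{\xi_1}\cap\bigcap_{l\ge1}(f^\star_{\xi_l}\circ\cdots\circ f^\star_{\xi_1})^{ -1}J^\star_{\xi_{l+1}}$ means that $x\in J^\star_{\xi_1}$ and successively $f^\star_{\xi_l}\circ\cdots\circ f^\star_{\xi_1}(x)\in J^\star_{\xi_{l+1}}$ for all $l\ge1$. Alphabet $F=\mathbb{Z}\setminus\{0,\pm1\}$; transition matrix $\mathbb{A}=(\mathbb{A}_{m,n})_{m,n\in F}$ with $\mathbb{A}_{m,n}=1$ if $n\ne2\,\mathrm{sign}(m)$ and $\mathbb{A}_{m,n}=0$ otherwise. $F_{\mathbb{A}}^{\mathbb{N}}=\{(\xi_i)_{i\in\mathbb{N}}:\xi_i\in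 F,\ \mathbb{A}_{\xi_i,\xi_{i+1}}=1\ \forall i\in\mathbb{N}\}$, with shift $(\tau\underline\xi)_i=\xi_{i+1}$. The sequence $\pm\underline{r}_3$ is the constant sequence with all entries $\pm3$. Finally $\partial\mathcal{M}(f_3^\star)=\{y\in I_{R_3}:\exists\,n\in\mathbb{Z}_{\ge0}\text{ with }(f_3^\star)^n(y)=\pm r_3\text{ or }(f_3^\star)^n(y)=0\}$. -}

module Defs where

open import Algebra.Bundles using (CommutativeRing)
import Algebra.Properties.Ring as RingProperties
import Algebra.Properties.Semiring.Mult as SemiringMult
import Algebra.Properties.Semiring.Mult.TCOptimised as SemiringMult′
import Algebra.Solver.Ring.NaturalCoefficients.Default as NatCoeff
open import Data.Bool.Base using (if_then_else_)
open import Data.Integer.Base using (ℤ; +_; -[1+_]; 0ℤ; 1ℤ; -1ℤ; sign; _◃_)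
  renaming (-_ to -ℤ_)
import Data.Integer.Base as ℤ
import Data.Integer.Properties as ℤ
import Data.Nat.Base as ℕ
open import Data.Nat.Base using (ℕ; zero; suc)
import Data.Nat.Properties as ℕ
open import Data.Nat.GeneralisedArithmetic using (fold)
open import Data.Product.Base using (Σ; ∃; ∃-syntax; _×_; _,_; proj₁; proj₂)
open import Data.Sum.Base using (_⊎_; inj₁; inj₂; [_,_]′)
open import Function.Base using (_∘_; const)
open import Level using (0ℓ)
open import Relation.Binary.Bundles using (Setoid; StrictTotalOrder)
open import Relation.Binary.Core using (Rel)
import Relation.Binary.Construct.On as On
import Relation.Binary.Construct.StrictToNonStrict as ToNonStrict
open import Relation.Binary.Definitions using (Tri; tri<; tri≈; tri>)
open import Relation.Binary.PropositionalEquality as ≡ using (_≡_; _≢_; _≗_; _→-setoid_)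
open import Relation.Binary.Structures using (IsStrictTotalOrder)
open import Relation.Nullary.Decidable.Core using (does; yes; no)
open import Relation.Nullary.Negation.Core using (¬_; contradiction)
open import Relation.Unary using (Pred; Satisfiable)

-- The axioms that characterise ℝ up to isomorphism.  As `supremum` applies to
-- arbitrary inhabited bounded predicates and `compare` decides the order,
-- these are the reals of classical mathematics.

record CompleteOrderedField : Set₁ where
  infix  4 _<_
  infix  9 _⁻¹
  field
    commutativeRing : CommutativeRing 0ℓ 0ℓ

  open CommutativeRing commutativeRing public hiding (zero)

  field
    _<_                : Rel Carrier 0ℓ
    isStrictTotalOrder : IsStrictTotalOrder _≈_ _<_
    0≉1                : ¬ 0# ≈ 1#
    +-monoˡ-<          : ∀ z {x y} → x < y → x + z < y + z
    *-pos              : ∀ {x y} → 0# < x → 0# < y → 0# < x * y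
    -- The value of 0# ⁻¹ is left unspecified.
    _⁻¹                : Carrier → Carrier
    ⁻¹-cong            : ∀ {x y} → x ≈ y → x ⁻¹ ≈ y ⁻¹
    *-inverseʳ         : ∀ {x} → ¬ x ≈ 0# → x * x ⁻¹ ≈ 1#

  open ToNonStrict _≈_ _<_ public using (_≤_)

  field
    supremum : (P : Pred Carrier 0ℓ) → Satisfiable P →
               (∃[ b ] ∀ {x} → P x → x ≤ b) →
               ∃[ s ] (∀ {x} → P x → x ≤ s) ×
                      (∀ {y} → y < s → ∃[ x ] P x × y < x)

module Reals (ℝ : CompleteOrderedField) where
  open CompleteOrderedField ℝ public

  open IsStrictTotalOrder isStrictTotalOrder public
    using (compare; <-resp-≈; <-respʳ-≈; <-respˡ-≈)
    renaming (trans to <-trans; irrefl to <-irrefl; asym to <-asym)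

  open SemiringMult semiring public using (×1-homo-*) renaming (_×_ to _·_)
  open SemiringMult′ semiring using () renaming (_×_ to _·′_; ×ᵤ≈× to ·≈·′)
  open RingProperties ring
    using (-‿involutive; -‿+-comm; -‿distribʳ-*; -‿distribˡ-*; -0#≈0#)
  open NatCoeff commutativeSemiring using (solve; _:=_; _:+_; _:*_; con)

  strictTotalOrder : StrictTotalOrder 0ℓ 0ℓ 0ℓ
  strictTotalOrder = record { isStrictTotalOrder = isStrictTotalOrder }

  open import Relation.Binary.Reasoning.StrictPartialOrder
    (StrictTotalOrder.strictPartialOrder strictTotalOrder)

  ι : ℤ → Carrier
  ι (+ n)    = n · 1#
  ι -[1+ n ] = - (suc n · 1#)

  ι-neg : ∀ m → ι (-ℤ m) ≈ - ι m
  ι-neg (+ zero)  = sym -0#≈0#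
  ι-neg (+ suc n) = refl
  ι-neg -[1+ n ]  = sym (-‿involutive _)

  ≮⇒≥ : ∀ {x y} → ¬ x < y → y ≤ x
  ≮⇒≥ {x} {y} x≮y with compare x y
  ... | tri< x<y _ _ = contradiction x<y x≮y
  ... | tri≈ _ x≈y _ = inj₂ (sym x≈y)
  ... | tri> _ _ y<x = inj₁ y<x

  ≤⇒≯ : ∀ {x y} → x ≤ y → ¬ y < x
  ≤⇒≯ (inj₁ x<y) = <-asym x<y
  ≤⇒≯ (inj₂ x≈y) = <-irrefl (sym x≈y)

  +-monoʳ-< : ∀ z {x y} → x < y → z + x < z + y
  +-monoʳ-< z {x} {y} x<y = begin-strict
    z + x  ≈⟨ +-comm z x ⟩
    x + z  <⟨ +-monoˡ-< z x<y ⟩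
    y + z  ≈⟨ +-comm y z ⟩
    z + y  ∎

  +-mono-< : ∀ {w x y z} → w < x → y < z → w + y < x + z
  +-mono-< w<x y<z = <-trans (+-monoˡ-< _ w<x) (+-monoʳ-< _ y<z)

  +-monoˡ-≤ : ∀ z {x y} → x ≤ y → x + z ≤ y + z
  +-monoˡ-≤ z (inj₁ x<y) = inj₁ (+-monoˡ-< z x<y)
  +-monoˡ-≤ z (inj₂ x≈y) = inj₂ (+-congʳ x≈y)

  ≤-resp : ∀ {x x′ y y′} → x ≈ x′ → y ≈ y′ → x ≤ y → x′ ≤ y′
  ≤-resp p q (inj₁ x<y) = inj₁ (<-respʳ-≈ q (<-respˡ-≈ p x<y))
  ≤-resp p q (inj₂ x≈y) = inj₂ (trans (sym p) (trans x≈y q))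

  +-monoʳ-≤ : ∀ z {x y} → x ≤ y → z + x ≤ z + y
  +-monoʳ-≤ z (inj₁ x<y) = inj₁ (+-monoʳ-< z x<y)
  +-monoʳ-≤ z (inj₂ x≈y) = inj₂ (+-congˡ x≈y)

  ≤-trans : ∀ {x y z} → x ≤ y → y ≤ z → x ≤ z
  ≤-trans = ToNonStrict.trans _≈_ _<_ isEquivalence <-resp-≈ <-trans

  x-y+y≈x : ∀ x y → (x - y) + y ≈ x
  x-y+y≈x x y = trans (+-assoc x (- y) y) (trans (+-congˡ (-‿inverseˡ y)) (+-identityʳ x))

  x+y-y≈x : ∀ x y → (x + y) - y ≈ x
  x+y-y≈x x y = trans (+-assoc x y (- y)) (trans (+-congˡ (-‿inverseʳ y)) (+-identityʳ x))

  neg-mono-< : ∀ {x y} → x < y → - y < - x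
  neg-mono-< {x} {y} x<y = begin-strict
    - y                ≈⟨ x+y-y≈x (- y) x ⟨
    (- y + x) - x      <⟨ +-monoˡ-< (- x) (+-monoʳ-< (- y) x<y) ⟩
    (- y + y) - x      ≈⟨ +-congʳ (-‿inverseˡ y) ⟩
    0# - x             ≈⟨ +-identityˡ (- x) ⟩
    - x                ∎

  neg-mono-≤ : ∀ {x y} → x ≤ y → - y ≤ - x
  neg-mono-≤ (inj₁ x<y) = inj₁ (neg-mono-< x<y)
  neg-mono-≤ (inj₂ x≈y) = inj₂ (-‿cong (sym x≈y))

  x<0⇒0<-x : ∀ {x} → x < 0# → 0# < - x
  x<0⇒0<-x x<0 = <-respˡ-≈ -0#≈0# (neg-mono-< x<0)

  ≤-pos : ∀ {x y} → 0# ≤ x → 0# < y → 0# < x + y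
  ≤-pos {x} {y} (inj₁ 0<x) 0<y = <-trans 0<y (<-respˡ-≈ (+-identityˡ y) (+-monoˡ-< y 0<x))
  ≤-pos {x} {y} (inj₂ 0≈x) 0<y = <-respʳ-≈ (trans (sym (+-identityˡ y)) (+-congʳ 0≈x)) 0<y

  *-monoˡ-< : ∀ {x y z} → 0# < z → x < y → x * z < y * z
  *-monoˡ-< {x} {y} {z} 0<z x<y = begin-strict
    x * z                    ≈⟨ +-identityˡ (x * z) ⟨
    0# + x * z               <⟨ +-monoˡ-< (x * z) (*-pos 0<y-x 0<z) ⟩
    (y - x) * z + x * z      ≈⟨ distribʳ z (y - x) x ⟨
    (y - x + x) * z          ≈⟨ *-congʳ (x-y+y≈x y x) ⟩
    y * z                    ∎
    where
    0<y-x : 0# < y - x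
    0<y-x = <-respˡ-≈ (-‿inverseʳ x) (+-monoˡ-< (- x) x<y)

  *-cancelʳ-< : ∀ {x y z} → 0# < z → x * z < y * z → x < y
  *-cancelʳ-< {x} {y} 0<z xz<yz with compare x y
  ... | tri< x<y _ _ = x<y
  ... | tri≈ _ x≈y _ = contradiction xz<yz (<-irrefl (*-congʳ x≈y))
  ... | tri> _ _ y<x = contradiction xz<yz (<-asym (*-monoˡ-< 0<z y<x))

  sq-mono-< : ∀ {x y} → 0# ≤ x → x < y → x * x < y * y
  sq-mono-< {x} {y} (inj₁ 0<x) x<y = begin-strict
    x * x  <⟨ *-monoˡ-< 0<x x<y ⟩
    y * x  ≈⟨ *-comm y x ⟩
    x * y  <⟨ *-monoˡ-< (<-trans 0<x x<y) x<y ⟩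
    y * y  ∎
  sq-mono-< {x} {y} (inj₂ 0≈x) x<y = begin-strict
    x * x  ≈⟨ *-congʳ 0≈x ⟨
    0# * x ≈⟨ zeroˡ x ⟩
    0#     <⟨ *-pos 0<y 0<y ⟩
    y * y  ∎
    where
    0<y : 0# < y
    0<y = <-respˡ-≈ (sym 0≈x) x<y

  0<1 : 0# < 1#
  0<1 with compare 0# 1#
  ... | tri< 0<1 _ _ = 0<1
  ... | tri≈ _ 0≈1 _ = contradiction 0≈1 0≉1
  ... | tri> _ _ 1<0 = contradiction 1<0 (<-asym (begin-strict
    0#             <⟨ *-pos (x<0⇒0<-x 1<0) (x<0⇒0<-x 1<0) ⟩
    - 1# * - 1#    ≈⟨ -‿distribʳ-* (- 1#) 1# ⟨
    - (- 1# * 1#)  ≈⟨ -‿cong (*-identityʳ (- 1#)) ⟩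
    - (- 1#)       ≈⟨ -‿involutive 1# ⟩
    1#             ∎))

  n·1<[1+n]·1 : ∀ n → n · 1# < suc n · 1#
  n·1<[1+n]·1 n = <-respˡ-≈ (+-identityˡ (n · 1#)) (+-monoˡ-< (n · 1#) 0<1)

  0<[1+n]·1 : ∀ n → 0# < suc n · 1#
  0<[1+n]·1 zero    = n·1<[1+n]·1 zero
  0<[1+n]·1 (suc n) = <-trans (0<[1+n]·1 n) (n·1<[1+n]·1 (suc n))

  ι-pred : ∀ m → - (m · 1#) ≈ ι -[1+ m ] + 1#
  ι-pred m = begin-equality
    - (m · 1#)                   ≈⟨ x-y+y≈x (- (m · 1#)) 1# ⟨
    (- (m · 1#) - 1#) + 1#       ≈⟨ +-congʳ (-‿+-comm (m · 1#) 1#) ⟩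
    - (m · 1# + 1#) + 1#         ≈⟨ +-congʳ (-‿cong (+-comm (m · 1#) 1#)) ⟩
    - (1# + m · 1#) + 1#         ∎

  ·1-mono-≤ : ∀ {m n} → m ℕ.≤ n → m · 1# ≤ n · 1#
  ·1-mono-≤ {n = zero}  ℕ.z≤n       = inj₂ refl
  ·1-mono-≤ {n = suc n} ℕ.z≤n       = inj₁ (0<[1+n]·1 n)
  ·1-mono-≤             (ℕ.s≤s m≤n) = +-monoʳ-≤ 1# (·1-mono-≤ m≤n)

  ι-gap : ∀ {m n} → m ℤ.< n → ι m + 1# ≤ ι n
  ι-gap {+ m} {+ n} (ℤ.+<+ m<n) =
    ≤-resp (+-comm 1# (m · 1#)) refl (·1-mono-≤ {suc m} {n} m<n)
  ι-gap { -[1+ m ]} {+ n} ℤ.-<+ = ≤-resp (ι-pred m) refl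
    (≤-trans (neg-mono-≤ (·1-mono-≤ {0} {m} ℕ.z≤n))
             (≤-resp (sym -0#≈0#) refl (·1-mono-≤ {0} {n} ℕ.z≤n)))
  ι-gap { -[1+ m ]} { -[1+ n ]} (ℤ.-<- n<m) =
    ≤-resp (ι-pred m) refl (neg-mono-≤ (·1-mono-≤ {suc n} {m} n<m))

  private
    below : Carrier → Pred Carrier 0ℓ
    below z y = ∃[ n ] y ≈ n · 1# × n · 1# ≤ z

  floor : ∀ z → 0# ≤ z → ∃[ n ] n · 1# ≤ z × z < suc n · 1#
  floor z 0≤z
    with s , upper , approx ← supremum (below z) (0# , 0 , refl , 0≤z)
                                (z , λ (_ , x≈n , n≤z) → ≤-resp (sym x≈n) refl n≤z)
    with p , (n , p≈n , n≤z) , s-1<p ← approx {s - 1#}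
           (begin-strict
             s - 1#        <⟨ +-monoʳ-< s (<-respʳ-≈ -0#≈0# (neg-mono-< 0<1)) ⟩
             s + 0#        ≈⟨ +-identityʳ s ⟩
             s             ∎)
    = n , n≤z , [ (λ z<1+n → z<1+n) , contradiction s<1+n ∘ ≤⇒≯ ∘ atMost ]′ (cases z (suc n · 1#))
    where
    cases : ∀ x y → x < y ⊎ y ≤ x
    cases x y with compare x y
    ... | tri< x<y _ _ = inj₁ x<y
    ... | tri≈ _ x≈y _ = inj₂ (inj₂ (sym x≈y))
    ... | tri> _ _ y<x = inj₂ (inj₁ y<x)
    atMost : suc n · 1# ≤ z → suc n · 1# ≤ s
    atMost 1+n≤z = upper (suc n , refl , 1+n≤z)
    s<1+n : s < suc n · 1#
    s<1+n = begin-strict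
      s               ≈⟨ x-y+y≈x s 1# ⟨
      (s - 1#) + 1#   <⟨ +-monoˡ-< 1# s-1<p ⟩
      p + 1#          ≈⟨ +-congʳ p≈n ⟩
      n · 1# + 1#     ≈⟨ +-comm (n · 1#) 1# ⟩
      suc n · 1#      ∎

  private
    0<[1+n]·′1 : ∀ n → 0# < suc n ·′ 1#
    0<[1+n]·′1 n = <-respʳ-≈ (·≈·′ (suc n) 1#) (0<[1+n]·1 n)

    5# : Carrier
    5# = 5 ·′ 1#

    below√5 : Pred Carrier 0ℓ
    below√5 y = y * y < 5#

    0<5 : 0# < 5#
    0<5 = 0<[1+n]·′1 4

    0∈below√5 : below√5 0#
    0∈below√5 = <-respˡ-≈ (sym (zeroˡ 0#)) 0<5

    below√5≤5 : ∀ {y} → below√5 y → y ≤ 5#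
    below√5≤5 {y} y²<5 = ≮⇒≥ λ 5<y → <-asym y²<5 (begin-strict
      5#        ≈⟨ *-identityˡ 5# ⟨
      1# * 5#   <⟨ *-monoˡ-< 0<5 (<-respˡ-≈ (+-identityˡ 1#) (+-monoˡ-< 1# (0<[1+n]·′1 3))) ⟩
      5# * 5#   <⟨ sq-mono-< (inj₁ 0<5) 5<y ⟩
      y * y     ∎)

    sup√5 : ∃[ s ] (∀ {x} → below√5 x → x ≤ s) ×
                   (∀ {y} → y < s → ∃[ x ] below√5 x × y < x)
    sup√5 = supremum below√5 (0# , 0∈below√5) (5# , below√5≤5)

  opaque
    √5 : Carrier
    √5 = proj₁ sup√5

    private
      upper : ∀ {x} → below√5 x → x ≤ √5
      upper = proj₁ (proj₂ sup√5)

      approx : ∀ {y} → y < √5 → ∃[ x ] below√5 x × y < x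
      approx = proj₂ (proj₂ sup√5)

  0≤√5 : 0# ≤ √5
  0≤√5 = upper 0∈below√5

  private
    -- With s = √5 and t = (5s + 5)/(s + 5), the signs of t² - 5 and s - t are
    -- those of s² - 5.
    s d t : Carrier
    s = √5
    d = s + 5#
    t = (5# * s + 5#) * d ⁻¹

    0<d : 0# < d
    0<d = ≤-pos 0≤√5 0<5

    td : t * d ≈ 5# * s + 5#
    td = begin-equality
      t * d                            ≈⟨ *-assoc _ (d ⁻¹) d ⟩
      (5# * s + 5#) * (d ⁻¹ * d)       ≈⟨ *-congˡ (*-comm (d ⁻¹) d) ⟩
      (5# * s + 5#) * (d * d ⁻¹)       ≈⟨ *-congˡ (*-inverseʳ λ d≈0 → <-irrefl (sym d≈0) 0<d) ⟩
      (5# * s + 5#) * 1#               ≈⟨ *-identityʳ _ ⟩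
      5# * s + 5#                      ∎

    sd : s * d ≈ s * s + 5# * s
    sd = trans (distribˡ s s 5#) (+-congˡ (*-comm s 5#))

    td′ : t * d ≈ 5# + 5# * s
    td′ = trans td (+-comm (5# * s) 5#)

    rest : Carrier
    rest = 5# * (s * s) + (50 ·′ 1#) * s + (25 ·′ 1#)

    t²d² : (t * t) * (d * d) ≈ (s * s) * (20 ·′ 1#) + rest
    t²d² = begin-equality
      (t * t) * (d * d)                  ≈⟨ solve 2 (λ a b → (a :* a) :* (b :* b) := (a :* b) :* (a :* b)) refl t d ⟩
      (t * d) * (t * d)                  ≈⟨ *-cong td td ⟩
      (5# * s + 5#) * (5# * s + 5#)      ≈⟨ solve 1 (λ a →
        (con 5 :* a :+ con 5) :* (con 5 :* a :+ con 5) :=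
        (a :* a) :* con 20 :+ (con 5 :* (a :* a) :+ con 50 :* a :+ con 25)) refl s ⟩
      (s * s) * (20 ·′ 1#) + rest         ∎

    5d² : 5# * (d * d) ≈ 5# * (20 ·′ 1#) + rest
    5d² = solve 1 (λ a →
      con 5 :* ((a :+ con 5) :* (a :+ con 5)) :=
      con 5 :* con 20 :+ (con 5 :* (a :* a) :+ con 50 :* a :+ con 25)) refl s

    s²≮5 : ¬ s * s < 5#
    s²≮5 s²<5 = ≤⇒≯ (upper t²<5) s<t
      where
      s<t : s < t
      s<t = *-cancelʳ-< 0<d (<-respʳ-≈ (sym td′) (<-respˡ-≈ (sym sd) (+-monoˡ-< (5# * s) s²<5)))
      t²<5 : t * t < 5#
      t²<5 = *-cancelʳ-< (*-pos 0<d 0<d) (begin-strict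
        (t * t) * (d * d)           ≈⟨ t²d² ⟩
        (s * s) * (20 ·′ 1#) + rest  <⟨ +-monoˡ-< rest (*-monoˡ-< (0<[1+n]·′1 19) s²<5) ⟩
        5# * (20 ·′ 1#) + rest       ≈⟨ 5d² ⟨
        5# * (d * d)                ∎)

    s²≯5 : ¬ 5# < s * s
    s²≯5 5<s² with p , p²<5 , t<p ← approx (
      *-cancelʳ-< 0<d (<-respʳ-≈ (sym sd) (<-respˡ-≈ (sym td′) (+-monoˡ-< (5# * s) 5<s²)))) =
      <-asym p²<5 (<-trans 5<t² (sq-mono-< (inj₁ 0<t) t<p))
      where
      5<t² : 5# < t * t
      5<t² = *-cancelʳ-< (*-pos 0<d 0<d) (begin-strict
        5# * (d * d)                ≈⟨ 5d² ⟩
        5# * (20 ·′ 1#) + rest       <⟨ +-monoˡ-< rest (*-monoˡ-< (0<[1+n]·′1 19) 5<s²) ⟩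
        (s * s) * (20 ·′ 1#) + rest  ≈⟨ t²d² ⟨
        (t * t) * (d * d)           ∎)
      0<t : 0# < t
      0<t = *-cancelʳ-< 0<d (begin-strict
        0# * d       ≈⟨ zeroˡ d ⟩
        0#           <⟨ *-pos (≤-pos 0≤√5 0<1) 0<5 ⟩
        (s + 1#) * 5#  ≈⟨ distribʳ 5# s 1# ⟩
        s * 5# + 1# * 5#  ≈⟨ +-cong (*-comm s 5#) (*-identityˡ 5#) ⟩
        5# * s + 5#  ≈⟨ td ⟨
        t * d        ∎)

  √5²≈5 : √5 * √5 ≈ ι (+ 5)
  √5²≈5 with compare (s * s) 5#
  ... | tri< s²<5 _ _ = contradiction s²<5 s²≮5
  ... | tri≈ _ s²≈5 _ = trans s²≈5 (sym (·≈·′ 5 1#))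
  ... | tri> _ _ 5<s² = contradiction 5<s² s²≯5

module RosenMap (ℝ : CompleteOrderedField) where
  open Reals ℝ public
  open IsStrictTotalOrder isStrictTotalOrder using (_≟_)
  open RingProperties ring using (-‿involutive; -‿+-comm; -0#≈0#)
  open import Relation.Binary.Reasoning.StrictPartialOrder
    (StrictTotalOrder.strictPartialOrder strictTotalOrder)

  R₃ : Carrier
  R₃ = (√5 - 1#) * ι (+ 2) ⁻¹

  r₃ : Carrier
  r₃ = R₃ - 1#

  I : Pred Carrier 0ℓ
  I y = - R₃ ≤ y × y ≤ R₃

  2R₃+1≈√5 : R₃ + R₃ + 1# ≈ √5
  2R₃+1≈√5 = begin-equality
    R₃ + R₃ + 1#                              ≈⟨ +-congʳ (distribˡ (√5 - 1#) h h) ⟨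
    (√5 - 1#) * (h + h) + 1#                  ≈⟨ +-congʳ (*-congˡ h+h≈1) ⟩
    (√5 - 1#) * 1# + 1#                       ≈⟨ +-congʳ (*-identityʳ (√5 - 1#)) ⟩
    (√5 - 1#) + 1#                            ≈⟨ x-y+y≈x √5 1# ⟩
    √5                                        ∎
    where
    h : Carrier
    h = ι (+ 2) ⁻¹
    h+h≈1 : h + h ≈ 1#
    h+h≈1 = begin-equality
      h + h                    ≈⟨ +-cong (*-identityˡ h) (*-identityˡ h) ⟨
      1# * h + 1# * h          ≈⟨ distribʳ h 1# 1# ⟨
      (1# + 1#) * h            ≈⟨ *-congʳ (+-congˡ (+-identityʳ 1#)) ⟨
      ι (+ 2) * h              ≈⟨ *-inverseʳ (λ 2≈0 → <-irrefl (sym 2≈0) (0<[1+n]·1 1)) ⟩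
      1#                       ∎

  2≤√5 : 2 · 1# ≤ √5
  2≤√5 = ≮⇒≥ λ √5<2 → <-asym (n·1<[1+n]·1 4) (begin-strict
    5 · 1#               ≈⟨ √5²≈5 ⟨
    √5 * √5              <⟨ sq-mono-< 0≤√5 √5<2 ⟩
    (2 · 1#) * (2 · 1#)  ≈⟨ ×1-homo-* 2 2 ⟨
    4 · 1#               ∎)

  √5≤3 : √5 ≤ 3 · 1#
  √5≤3 = ≮⇒≥ λ 3<√5 → ≤⇒≯ (·1-mono-≤ {5} {9} (ℕ.m≤m+n 5 4)) (begin-strict
    9 · 1#               ≈⟨ ×1-homo-* 3 3 ⟩
    (3 · 1#) * (3 · 1#)  <⟨ sq-mono-< (inj₁ (0<[1+n]·1 2)) 3<√5 ⟩
    √5 * √5              ≈⟨ √5²≈5 ⟩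
    5 · 1#               ∎)

  2x+1 : ∀ x → (x + x) + 1# ≈ 1# + (x + (x + 0#))
  2x+1 x = trans (+-comm _ 1#) (+-congˡ (+-congˡ (sym (+-identityʳ x))))

  R₃≤1 : R₃ ≤ 1#
  R₃≤1 = ≮⇒≥ λ 1<R₃ → ≤⇒≯ √5≤3 (begin-strict
    3 · 1#            ≈⟨ 2x+1 1# ⟨
    (1# + 1#) + 1#    <⟨ +-monoˡ-< 1# (+-mono-< 1<R₃ 1<R₃) ⟩
    (R₃ + R₃) + 1#    ≈⟨ 2R₃+1≈√5 ⟩
    √5                ∎)

  1≤R₃+R₃ : 1# ≤ R₃ + R₃
  1≤R₃+R₃ = ≮⇒≥ λ 2R₃<1 → ≤⇒≯ 2≤√5 (begin-strict
    √5                ≈⟨ 2R₃+1≈√5 ⟨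
    (R₃ + R₃) + 1#    <⟨ +-monoˡ-< 1# 2R₃<1 ⟩
    1# + 1#           ≈⟨ +-congˡ (+-identityʳ 1#) ⟨
    2 · 1#            ∎)

  0≤R₃ : 0# ≤ R₃
  0≤R₃ = ≮⇒≥ λ R₃<0 → ≤⇒≯ 1≤R₃+R₃ (begin-strict
    R₃ + R₃   <⟨ +-mono-< R₃<0 R₃<0 ⟩
    0# + 0#   ≈⟨ +-identityʳ 0# ⟩
    0#        <⟨ 0<1 ⟩
    1#        ∎)

  r₃≤0 : r₃ ≤ 0#
  r₃≤0 = ≤-resp refl (-‿inverseʳ 1#) (+-monoˡ-≤ (- 1#) R₃≤1)

  -R₃≤r₃ : - R₃ ≤ r₃
  -R₃≤r₃ = ≤-resp
    (trans (+-comm 1# _) (trans (+-congʳ (sym (-‿+-comm R₃ 1#))) (x-y+y≈x (- R₃) 1#)))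
    (trans (+-congˡ (sym (-‿+-comm R₃ 1#))) (shuffle R₃))
    (+-monoˡ-≤ (- (R₃ + 1#)) 1≤R₃+R₃)
    where
    shuffle : ∀ x → (x + x) + (- x - 1#) ≈ x - 1#
    shuffle x = trans (sym (+-assoc (x + x) (- x) (- 1#))) (+-congʳ (x+y-y≈x x x))

  r₃+1≈R₃ : r₃ + 1# ≈ R₃
  r₃+1≈R₃ = x-y+y≈x R₃ 1#

  +r₃+1 : ∀ x → x + 1# + r₃ ≈ x + R₃
  +r₃+1 x = trans (+-assoc x 1# r₃) (+-congˡ (trans (+-comm 1# r₃) r₃+1≈R₃))

  0∈I : I 0#
  0∈I = ≤-resp refl -0#≈0# (neg-mono-≤ 0≤R₃) , 0≤R₃

  I-neg : ∀ {y} → I y → I (- y)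
  I-neg (-R₃≤y , y≤R₃) =
    neg-mono-≤ y≤R₃ , ≤-resp refl (-‿involutive R₃) (neg-mono-≤ -R₃≤y)

  near : ∀ x → ∃[ n ] n · 1# ≤ x - r₃ × x - r₃ < suc n · 1# →
         ∃[ n ] ι n + r₃ ≤ x × x < ι n + R₃
  near x (n , n≤x-r₃ , x-r₃<1+n)
    = + n
    , ≤-resp refl (x-y+y≈x x r₃) (+-monoˡ-≤ r₃ n≤x-r₃)
    , (begin-strict
        x                     ≈⟨ x-y+y≈x x r₃ ⟨
        (x - r₃) + r₃         <⟨ +-monoˡ-< r₃ x-r₃<1+n ⟩
        (1# + n · 1#) + r₃    ≈⟨ +-congʳ (+-comm 1# (n · 1#)) ⟩
        (n · 1# + 1#) + r₃    ≈⟨ +r₃+1 (n · 1#) ⟩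
        n · 1# + R₃           ∎)

  0≤x-r₃ : ∀ {x} → 0# ≤ x → 0# ≤ x - r₃
  0≤x-r₃ {x} 0≤x = ≤-trans 0≤x (≤-resp (+-identityʳ x) refl
    (+-monoʳ-≤ x (≤-resp -0#≈0# refl (neg-mono-≤ r₃≤0))))

  opaque
    nearest : ∀ x → 0# ≤ x → ∃[ n ] ι n + r₃ ≤ x × x < ι n + R₃
    nearest x 0≤x = near x (floor (x - r₃) (0≤x-r₃ 0≤x))

  nearest-unique : ∀ {x m n} → ι m + r₃ ≤ x × x < ι m + R₃ →
                   ι n + r₃ ≤ x × x < ι n + R₃ → m ≡ n
  nearest-unique {x} {m} {n} (m≤x , x<m) (n≤x , x<n) with ℤ.<-cmp m n
  ... | tri< m<n _ _ = contradiction x<m (≤⇒≯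
        (≤-trans (≤-resp (+r₃+1 (ι m)) refl (+-monoˡ-≤ r₃ (ι-gap m<n))) n≤x))
  ... | tri≈ _ m≡n _ = m≡n
  ... | tri> _ _ n<m = contradiction x<n (≤⇒≯
        (≤-trans (≤-resp (+r₃+1 (ι n)) refl (+-monoˡ-≤ r₃ (ι-gap n<m))) m≤x))

  ⟨_⟩⋆ : Carrier → ℤ
  ⟨ x ⟩⋆ with compare x 0#
  ... | tri< x<0 _ _ = -ℤ proj₁ (nearest (- x) (inj₁ (x<0⇒0<-x x<0)))
  ... | tri≈ _ x≈0 _ = proj₁ (nearest x (inj₂ (sym x≈0)))
  ... | tri> _ _ 0<x = proj₁ (nearest x (inj₁ 0<x))

  nearest∈I : ∀ {x} ((n , _) : ∃[ n ] ι n + r₃ ≤ x × x < ι n + R₃) → I (x - ι n)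
  nearest∈I (n , n+r₃≤x , x<n+R₃)
    = ≤-trans -R₃≤r₃ (≤-resp (cancel (ι n) r₃) refl (+-monoˡ-≤ (- ι n) n+r₃≤x))
    , inj₁ (<-respʳ-≈ (cancel (ι n) R₃) (+-monoˡ-< (- ι n) x<n+R₃))
    where
    cancel : ∀ a b → (a + b) - a ≈ b
    cancel a b = trans (+-congʳ (+-comm a b)) (x+y-y≈x b a)

  opaque
    x-⟨x⟩⋆∈I : ∀ x → I (x - ι ⟨ x ⟩⋆)
    x-⟨x⟩⋆∈I x with compare x 0#
    ... | tri≈ _ x≈0 _ = nearest∈I (nearest x (inj₂ (sym x≈0)))
    ... | tri> _ _ 0<x = nearest∈I (nearest x (inj₁ 0<x))
    ... | tri< x<0 _ _ = I-resp eq (I-neg (nearest∈I (nearest (- x) 0≤-x)))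
      where
      0≤-x : 0# ≤ - x
      0≤-x = inj₁ (x<0⇒0<-x x<0)
      n : ℤ
      n = proj₁ (nearest (- x) 0≤-x)
      I-resp : ∀ {y z} → y ≈ z → I y → I z
      I-resp y≈z (l , u) = ≤-resp refl y≈z l , ≤-resp y≈z refl u
      eq : - (- x - ι n) ≈ x - ι (-ℤ n)
      eq = begin-equality
        - (- x - ι n)        ≈⟨ -‿+-comm (- x) (- ι n) ⟨
        - (- x) - (- ι n)    ≈⟨ +-congʳ (-‿involutive x) ⟩
        x - (- ι n)          ≈⟨ +-congˡ (-‿cong (ι-neg n)) ⟨
        x - ι (-ℤ n)         ∎

  𝕀 : Setoid 0ℓ 0ℓ
  𝕀 = On.setoid {B = ∃ I} setoid proj₁

  f⋆ : ∃ I → ∃ I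
  f⋆ (y , _) with y ≟ 0#
  ... | yes _ = 0# , 0∈I
  ... | no  _ = - y ⁻¹ - ι ⟨ - y ⁻¹ ⟩⋆ , x-⟨x⟩⋆∈I (- y ⁻¹)

  f⋆^ : ℕ → ∃ I → ∃ I
  f⋆^ n y = fold y f⋆ n

  ∂ℳ : Pred (∃ I) 0ℓ
  ∂ℳ y = ∃[ n ] let z = proj₁ (f⋆^ n y) in (z ≈ r₃ ⊎ z ≈ - r₃) ⊎ z ≈ 0#

  𝕀∖∂ℳ : Setoid 0ℓ 0ℓ
  𝕀∖∂ℳ = On.setoid {B = ∃ λ y → ¬ ∂ℳ y} 𝕀 proj₁

  -- The sets F and J m and the branches below are only meant for m ∉ {0, ±1};
  -- `F` is imposed wherever they are used.
  F : Pred ℤ 0ℓ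
  F m = m ≢ 0ℤ × m ≢ 1ℤ × m ≢ -1ℤ

  J⁺ : ℕ → Pred Carrier 0ℓ
  J⁺ m y = - (r₃ + ι (+ m)) ⁻¹ ≤ y × y ≤ - (r₃ + ι (+ m) + 1#) ⁻¹

  J : ℤ → Pred Carrier 0ℓ
  J (+ m)    y = J⁺ m y
  J -[1+ m ] y = J⁺ (suc m) (- y)

  branch : ℤ → Carrier → Carrier
  branch m x = - x ⁻¹ - ι m

  -- branches ξ l = f_{ξ (l-1)} ∘ ⋯ ∘ f_{ξ 0}; sequences are indexed from 0.
  branches : (ℕ → ℤ) → ℕ → Carrier → Carrier
  branches ξ zero    x = x
  branches ξ (suc l) x = branch (ξ l) (branches ξ l x)

  𝔸 : ℤ → ℤ → ℕ
  𝔸 m n = if does (n ℤ.≟ sign m ◃ 2) then 0 else 1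

  Admissible : Pred (ℕ → ℤ) 0ℓ
  Admissible ξ = (∀ i → F (ξ i)) × (∀ i → 𝔸 (ξ i) (ξ (suc i)) ≡ 1)

  τ : (ℕ → ℤ) → (ℕ → ℤ)
  τ ξ i = ξ (suc i)

  τ^ : ℕ → (ℕ → ℤ) → (ℕ → ℤ)
  τ^ n ξ = fold ξ τ n

  EventuallyConstant±3 : Pred (ℕ → ℤ) 0ℓ
  EventuallyConstant±3 ξ = ∃[ n ] (τ^ n ξ ≗ const (+ 3) ⊎ τ^ n ξ ≗ const (-ℤ + 3))

  F_𝔸 : Setoid 0ℓ 0ℓ
  F_𝔸 = On.setoid {B = ∃ Admissible} (ℕ →-setoid ℤ) proj₁

  F_𝔸∖±3 : Setoid 0ℓ 0ℓ
  F_𝔸∖±3 = On.setoid {B = ∃ λ ξ → ¬ EventuallyConstant±3 (proj₁ ξ)} F_𝔸 proj₁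

  fold-shift : ∀ {A : Set} (g : A → A) x n → fold (g x) g n ≡ fold x g (suc n)
  fold-shift g x zero    = ≡.refl
  fold-shift g x (suc n) = ≡.cong g (fold-shift g x n)

  f⋆-restricted : Setoid.Carrier 𝕀∖∂ℳ → Setoid.Carrier 𝕀∖∂ℳ
  f⋆-restricted (y , y∉∂ℳ) = f⋆ y , λ (n , hit) → y∉∂ℳ
    (suc n , ≡.subst (λ w → (proj₁ w ≈ r₃ ⊎ proj₁ w ≈ - r₃) ⊎ proj₁ w ≈ 0#)
                     (fold-shift f⋆ y n) hit)

  τ-restricted : Setoid.Carrier F_𝔸∖±3 → Setoid.Carrier F_𝔸∖±3
  τ-restricted ((ξ , ξ∈F , 𝔸≡1) , ξ∉) =
    (τ ξ , ξ∈F ∘ suc , 𝔸≡1 ∘ suc) , λ (n , τⁿξ≗±3) → ξ∉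
    (suc n , ≡.subst (λ η → η ≗ _ ⊎ η ≗ _) (fold-shift τ ξ n) τⁿξ≗±3)

  Itinerary : ∃ I → Pred (ℕ → ℤ) 0ℓ
  Itinerary x ξ = ∀ i → J (ξ i) (proj₁ (f⋆^ i x))

  -- x ∈ J_{ξ 0} ∩ ⋂_{l ≥ 1} (f_{ξ (l-1)} ∘ ⋯ ∘ f_{ξ 0})⁻¹ J_{ξ l}
  Nested : (ℕ → ℤ) → Pred (∃ I) 0ℓ
  Nested ξ x = ∀ l → J (ξ l) (branches ξ l (proj₁ x))

{-# OPTIONS --safe #-}
-- Every branch f_m maps J_m increasingly onto [r₃, R₃] or its negative, according to
-- the sign of m, and expands distances by at least R₃⁻² > 2.  A transition m → n is
-- admissible exactly when J_n lies in the image of f_m, so an admissible ξ pulls back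
-- to a nested sequence of closed intervals; it has a common point by completeness and
-- only one by expansion.  Codes are ambiguous only where ⟨_⟩⋆ breaks a tie between the
-- closed intervals J_m, that is, where an orbit meets ±R₃ or ±r₃.  As ±r₃ is fixed by
-- f_{±3} and ±R₃ is sent by f_{∓2} to ∓r₃, the admissible expansions of such points end
-- in constant ±3.
module Submission where

open import Defs
open import Algebra.Solver.Ring.AlmostCommutativeRing
  using (fromCommutativeRing; _-Raw-AlmostCommutative⟶_)
import Algebra.Properties.Ring as RingProperties
import Algebra.Properties.Semiring.Mult as SemiringMult
import Algebra.Properties.Semiring.Mult.TCOptimised as SemiringMult′
import Algebra.Solver.Ring as RingSolver
open import Data.Integer.Base as ℤ using (ℤ; +_; -[1+_]; sign; _◃_; ∣_∣; _⊖_)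
import Data.Integer.Properties as ℤ
import Data.Maybe.Base as Maybe
open import Data.Nat.Base as ℕ using (ℕ; zero; suc)
import Data.Nat.Properties as ℕ
open import Data.Product.Base using (∃; Σ-syntax; ∃-syntax; _×_; _,_; proj₁; proj₂)
open import Data.Sign.Base as Sign using (Sign)
open import Data.Sum.Base using (_⊎_; inj₁; inj₂; map₂)
open import Function.Base using (_∘_; const)
open import Function.Bundles using (Bijection; Func; _⇔_; mk⇔)
open import Level using (0ℓ)
open import Relation.Binary.Bundles using (Setoid; StrictTotalOrder)
open import Relation.Binary.Consequences using (dec⇒weaklyDec)
open import Relation.Binary.Definitions using (tri<; tri≈; tri>)
open import Relation.Binary.PropositionalEquality as ≡ using (_≡_; _≢_; _≗_)
open import Relation.Binary.Structures using (IsStrictTotalOrder)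
open import Relation.Nullary.Decidable.Core using (yes; no)
open import Relation.Nullary.Negation.Core using (¬_; contradiction)
open import Relation.Unary using (Pred)

-- All exact values rest on R₃² + R₃ = 1, which gives 1/R₃ = R₃ + 1 and 1/r₃ = -(R₃ + 2), so that
-- the branches send the critical end points ±R₃ and ±r₃ to one another. The obstacle is that two
-- dynamics have to be reconciled: `f⋆` chooses its digit by rounding to a half-open interval, while
-- `branches ξ` follows prescribed digits through closed intervals. They part only at a tie, where
-- the branch arrives at ±R₃ and `f⋆` at ±r₃. Starting from a point outside `∂ℳ`, a tie is
-- impossible because the orbit under `f⋆` avoids ±r₃. Starting from an admissible sequence, it is
-- impossible because a branch orbit that meets ±R₃ forces the sequence to end in constant ±3. Each
-- direction thus uses the exclusion made on its own side.

-- Signs, and the integers inside the field.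

module Arithmetic (ℝ : CompleteOrderedField) where
  open Reals ℝ
  open RingProperties ring
  open SemiringMult semiring using (×-homo-+)
  open SemiringMult′ semiring using () renaming (_×_ to _·′_; ×ᵤ≈× to ·≈·′)
  open import Relation.Binary.Reasoning.StrictPartialOrder
    (StrictTotalOrder.strictPartialOrder strictTotalOrder)

  -- Makes the symmetry x ↦ -x explicit: the branches of m and -m are conjugate under it, so both
  -- signs share one statement and the negative case is reduced to the positive one.
  σ : Sign → Carrier → Carrier
  σ Sign.+ x = x
  σ Sign.- x = - x

  σ-cong : ∀ s {x y} → x ≈ y → σ s x ≈ σ s y
  σ-cong Sign.+ x≈y = x≈y
  σ-cong Sign.- x≈y = -‿cong x≈y

  σ-involutive : ∀ s x → σ s (σ s x) ≈ x
  σ-involutive Sign.+ x = refl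
  σ-involutive Sign.- x = -‿involutive x

  σ-*-σ : ∀ s t x y → σ (s Sign.* t) (x * y) ≈ σ s x * σ t y
  σ-*-σ Sign.+ Sign.+ x y = refl
  σ-*-σ Sign.+ Sign.- x y = -‿distribʳ-* x y
  σ-*-σ Sign.- Sign.+ x y = -‿distribˡ-* x y
  σ-*-σ Sign.- Sign.- x y = begin-equality
    x * y          ≈⟨ -‿involutive (x * y) ⟨
    - (- (x * y))  ≈⟨ -‿cong (-‿distribˡ-* x y) ⟩
    - (- x * y)    ≈⟨ -‿distribʳ-* (- x) y ⟩
    - x * - y      ∎

  ι-◃ : ∀ s n → ι (s ◃ n) ≈ σ s (n · 1#)
  ι-◃ Sign.+ zero    = refl
  ι-◃ Sign.- zero    = sym -0#≈0#
  ι-◃ Sign.+ (suc n) = refl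
  ι-◃ Sign.- (suc n) = refl

  ι-sign-abs : ∀ m → ι m ≈ σ (sign m) (∣ m ∣ · 1#)
  ι-sign-abs (+ n)    = refl
  ι-sign-abs -[1+ n ] = refl

  ι-⊖ : ∀ m n → ι (m ⊖ n) ≈ m · 1# - n · 1#
  ι-⊖ zero    zero    = sym (-‿inverseʳ 0#)
  ι-⊖ zero    (suc n) = sym (+-identityˡ _)
  ι-⊖ (suc m) zero    = sym (trans (+-congˡ -0#≈0#) (+-identityʳ _))
  ι-⊖ (suc m) (suc n) = begin-equality
    ι (suc m ⊖ suc n)                     ≡⟨ ≡.cong ι (ℤ.[1+m]⊖[1+n]≡m⊖n m n) ⟩
    ι (m ⊖ n)                             ≈⟨ ι-⊖ m n ⟩
    m · 1# - n · 1#                       ≈⟨ +-congʳ (x+y-y≈x (m · 1#) 1#) ⟨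
    ((m · 1# + 1#) - 1#) - n · 1#         ≈⟨ +-assoc _ (- 1#) (- (n · 1#)) ⟩
    (m · 1# + 1#) + (- 1# - n · 1#)       ≈⟨ +-cong (+-comm _ 1#) (-‿+-comm 1# _) ⟩
    (1# + m · 1#) - (1# + n · 1#)         ∎

  ι-homo-+ : ∀ m n → ι (m ℤ.+ n) ≈ ι m + ι n
  ι-homo-+ (+ m)    (+ n)    = ×-homo-+ 1# m n
  ι-homo-+ (+ m)    -[1+ n ] = ι-⊖ m (suc n)
  ι-homo-+ -[1+ m ] (+ n)    = trans (ι-⊖ n (suc m)) (+-comm _ _)
  ι-homo-+ -[1+ m ] -[1+ n ] = begin-equality
    - (suc (suc (m ℕ.+ n)) · 1#)       ≡⟨ ≡.cong (λ k → - (suc k · 1#)) (ℕ.+-suc m n) ⟨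
    - ((suc m ℕ.+ suc n) · 1#)         ≈⟨ -‿cong (×-homo-+ 1# (suc m) (suc n)) ⟩
    - (suc m · 1# + suc n · 1#)        ≈⟨ -‿+-comm _ _ ⟨
    - (suc m · 1#) - (suc n · 1#)      ∎

  ι-homo-* : ∀ m n → ι (m ℤ.* n) ≈ ι m * ι n
  ι-homo-* m n = begin-equality
    ι (m ℤ.* n)                                         ≈⟨ ι-◃ (sign m Sign.* sign n) (∣ m ∣ ℕ.* ∣ n ∣) ⟩
    σ s ((∣ m ∣ ℕ.* ∣ n ∣) · 1#)                        ≈⟨ σ-cong s (×1-homo-* ∣ m ∣ ∣ n ∣) ⟩
    σ s (∣ m ∣ · 1# * ∣ n ∣ · 1#)                       ≈⟨ σ-*-σ (sign m) (sign n) _ _ ⟩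
    σ (sign m) (∣ m ∣ · 1#) * σ (sign n) (∣ n ∣ · 1#)   ≈⟨ *-cong (ι-sign-abs m) (ι-sign-abs n) ⟨
    ι m * ι n                                           ∎
    where s = sign m Sign.* sign n

  -- Unlike ι this satisfies ⟦ + 1 ⟧ = 1# definitionally, so that solver
  -- constants match the 1# and 0# occurring in goals.
  ⟦_⟧ℤ : ℤ → Carrier
  ⟦ + n ⟧ℤ      = n ·′ 1#
  ⟦ -[1+ n ] ⟧ℤ = - (suc n ·′ 1#)

  ι≈⟦⟧ : ∀ m → ι m ≈ ⟦ m ⟧ℤ
  ι≈⟦⟧ (+ n)    = ·≈·′ n 1#
  ι≈⟦⟧ -[1+ n ] = -‿cong (·≈·′ (suc n) 1#)

  ℤ⟶ℝ : ℤ.+-*-rawRing -Raw-AlmostCommutative⟶ fromCommutativeRing commutativeRing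
  ℤ⟶ℝ = record
    { ⟦_⟧    = ⟦_⟧ℤ
    ; +-homo = λ m n → trans (sym (ι≈⟦⟧ (m ℤ.+ n)))
                        (trans (ι-homo-+ m n) (+-cong (ι≈⟦⟧ m) (ι≈⟦⟧ n)))
    ; *-homo = λ m n → trans (sym (ι≈⟦⟧ (m ℤ.* n)))
                        (trans (ι-homo-* m n) (*-cong (ι≈⟦⟧ m) (ι≈⟦⟧ n)))
    ; -‿homo = λ m → trans (sym (ι≈⟦⟧ (ℤ.- m))) (trans (ι-neg m) (-‿cong (ι≈⟦⟧ m)))
    ; 0-homo = refl
    ; 1-homo = refl
    }

  open RingSolver ℤ.+-*-rawRing (fromCommutativeRing commutativeRing) ℤ⟶ℝ
    (λ m n → Maybe.map (λ m≡n → reflexive (≡.cong ⟦_⟧ℤ m≡n)) (dec⇒weaklyDec ℤ._≟_ m n))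
    public using (solve; _:=_; _:+_; _:*_; _:-_; :-_; con)

-- Order and reciprocals in an ordered field.

module Inverses (ℝ : CompleteOrderedField) where
  open Reals ℝ
  open Arithmetic ℝ
  open RingProperties ring
  open import Relation.Binary.Reasoning.StrictPartialOrder
    (StrictTotalOrder.strictPartialOrder strictTotalOrder)

  private
    transport-difference : ∀ {w x y z} → x - w ≈ z - y → x + (y - w) ≈ z
    transport-difference {w} {x} {y} {z} x-w≈z-y = begin-equality
      x + (y - w)   ≈⟨ solve 3 (λ x y w → x :+ (y :- w) := (x :- w) :+ y) refl x y w ⟩
      (x - w) + y   ≈⟨ +-congʳ x-w≈z-y ⟩
      (z - y) + y   ≈⟨ x-y+y≈x z y ⟩
      z             ∎

    w+[y-w]≈y : ∀ w y → w + (y - w) ≈ y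
    w+[y-w]≈y = solve 2 (λ w y → w :+ (y :- w) := y) refl

  -- Reduces any rearrangement of an inequality to a single ring identity between differences, which
  -- the solver can check.
  ≤-by-difference : ∀ {w x y z} → x - w ≈ z - y → w ≤ x → y ≤ z
  ≤-by-difference {w} {x} {y} eq w≤x =
    ≤-resp (w+[y-w]≈y w y) (transport-difference eq) (+-monoˡ-≤ (y - w) w≤x)

  <-by-difference : ∀ {w x y z} → x - w ≈ z - y → w < x → y < z
  <-by-difference {w} {x} {y} eq w<x =
    <-respʳ-≈ (transport-difference eq) (<-respˡ-≈ (w+[y-w]≈y w y) (+-monoˡ-< (y - w) w<x))

  <-≤-trans : ∀ {x y z} → x < y → y ≤ z → x < z
  <-≤-trans x<y (inj₁ y<z) = <-trans x<y y<z
  <-≤-trans x<y (inj₂ y≈z) = <-respʳ-≈ y≈z x<y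

  ≤-<-trans : ∀ {x y z} → x ≤ y → y < z → x < z
  ≤-<-trans (inj₁ x<y) y<z = <-trans x<y y<z
  ≤-<-trans (inj₂ x≈y) y<z = <-respˡ-≈ (sym x≈y) y<z

  ≤-antisym : ∀ {x y} → x ≤ y → y ≤ x → x ≈ y
  ≤-antisym (inj₂ x≈y) _   = x≈y
  ≤-antisym (inj₁ x<y) y≤x = contradiction x<y (≤⇒≯ y≤x)

  0<⇒≉0 : ∀ {x} → 0# < x → ¬ x ≈ 0#
  0<⇒≉0 0<x x≈0 = <-irrefl (sym x≈0) 0<x

  <0⇒≉0 : ∀ {x} → x < 0# → ¬ x ≈ 0#
  <0⇒≉0 x<0 x≈0 = <-irrefl x≈0 x<0

  *-inverseˡ : ∀ {x} → ¬ x ≈ 0# → x ⁻¹ * x ≈ 1#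
  *-inverseˡ x≉0 = trans (*-comm _ _) (*-inverseʳ x≉0)

  -- A product equal to 1 already excludes x ≈ 0, so explicit reciprocals follow from polynomial
  -- identities alone.
  ⁻¹-unique : ∀ {x y} → x * y ≈ 1# → y ≈ x ⁻¹
  ⁻¹-unique {x} {y} xy≈1 = begin-equality
    y                  ≈⟨ *-identityˡ y ⟨
    1# * y             ≈⟨ *-congʳ (*-inverseˡ x≉0) ⟨
    (x ⁻¹ * x) * y     ≈⟨ *-assoc _ x y ⟩
    x ⁻¹ * (x * y)     ≈⟨ *-congˡ xy≈1 ⟩
    x ⁻¹ * 1#          ≈⟨ *-identityʳ _ ⟩
    x ⁻¹               ∎
    where
    x≉0 : ¬ x ≈ 0#
    x≉0 x≈0 = 0≉1 (trans (sym (zeroˡ y)) (trans (*-congʳ (sym x≈0)) xy≈1))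

  ⁻¹-involutive : ∀ {x} → ¬ x ≈ 0# → (x ⁻¹) ⁻¹ ≈ x
  ⁻¹-involutive x≉0 = sym (⁻¹-unique (*-inverseˡ x≉0))

  ⁻¹-neg : ∀ {x} → ¬ x ≈ 0# → (- x) ⁻¹ ≈ - x ⁻¹
  ⁻¹-neg {x} x≉0 = sym (⁻¹-unique (trans
    (solve 2 (λ x y → (:- x) :* (:- y) := x :* y) refl x (x ⁻¹)) (*-inverseʳ x≉0)))

  ⁻¹-pos : ∀ {x} → 0# < x → 0# < x ⁻¹
  ⁻¹-pos {x} 0<x = *-cancelʳ-< 0<x (begin-strict
    0# * x    ≈⟨ zeroˡ x ⟩
    0#        <⟨ 0<1 ⟩
    1#        ≈⟨ *-inverseˡ (0<⇒≉0 0<x) ⟨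
    x ⁻¹ * x  ∎)

  ⁻¹-anti-≤ : ∀ {x y} → 0# < x → x ≤ y → y ⁻¹ ≤ x ⁻¹
  ⁻¹-anti-≤ {x} {y} 0<x x≤y = ≮⇒≥ λ x⁻¹<y⁻¹ → ≤⇒≯ x≤y (begin-strict
    y                 ≈⟨ cancel x y (0<⇒≉0 0<x) ⟨
    x ⁻¹ * (x * y)    <⟨ *-monoˡ-< (*-pos 0<x 0<y) x⁻¹<y⁻¹ ⟩
    y ⁻¹ * (x * y)    ≈⟨ *-congˡ (*-comm x y) ⟩
    y ⁻¹ * (y * x)    ≈⟨ cancel y x (0<⇒≉0 0<y) ⟩
    x                 ∎)
    where
    0<y : 0# < y
    0<y = <-≤-trans 0<x x≤y
    cancel : ∀ u v → ¬ u ≈ 0# → u ⁻¹ * (u * v) ≈ v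
    cancel u v u≉0 = trans (sym (*-assoc _ u v)) (trans (*-congʳ (*-inverseˡ u≉0)) (*-identityˡ v))

  *-cancelʳ : ∀ {x y z} → ¬ z ≈ 0# → x * z ≈ y * z → x ≈ y
  *-cancelʳ {x} {y} {z} z≉0 xz≈yz = begin-equality
    x               ≈⟨ undo x ⟨
    (x * z) * z ⁻¹  ≈⟨ *-congʳ xz≈yz ⟩
    (y * z) * z ⁻¹  ≈⟨ undo y ⟩
    y               ∎
    where
    undo : ∀ u → (u * z) * z ⁻¹ ≈ u
    undo u = trans (*-assoc u z _) (trans (*-congˡ (*-inverseʳ z≉0)) (*-identityʳ u))

  -0< : ∀ {x} → - x < 0# → 0# < x
  -0< {x} -x<0 = <-respʳ-≈ (-‿involutive x) (x<0⇒0<-x -x<0)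

  0<⇒-<0 : ∀ {x} → 0# < x → - x < 0#
  0<⇒-<0 0<x = <-respʳ-≈ -0#≈0# (neg-mono-< 0<x)

  σ-≉0 : ∀ s {x} → σ s x < 0# → ¬ x ≈ 0#
  σ-≉0 Sign.+ x<0  x≈0 = <-irrefl x≈0 x<0
  σ-≉0 Sign.- -x<0 x≈0 = <-irrefl (sym x≈0) (-0< -x<0)

-- Golden ratio identities and the intervals of positive digits.

module GoldenRatio (ℝ : CompleteOrderedField) where
  open RosenMap ℝ
  open Arithmetic ℝ
  open Inverses ℝ
  open RingProperties ring
  open import Relation.Binary.Reasoning.StrictPartialOrder
    (StrictTotalOrder.strictPartialOrder strictTotalOrder)

  -- Absolute values of digits are written 2 + k, so that k ranges over all naturals and no lower
  -- bound has to be carried along.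
  K : ℕ → Carrier
  K k = ι (+ (2 ℕ.+ k))

  -- Multiplication by 4 completes the square: 4 (R₃² + R₃) = (2 R₃ + 1)² - 1 = 5 - 1.
  R₃²+R₃≈1 : R₃ * R₃ + R₃ ≈ 1#
  R₃²+R₃≈1 = *-cancelʳ (0<⇒≉0 (0<[1+n]·1 3)) (begin-equality
    (R₃ * R₃ + R₃) * ι (+ 4)                    ≈⟨ *-congˡ (ι≈⟦⟧ (+ 4)) ⟩
    (R₃ * R₃ + R₃) * ⟦ + 4 ⟧ℤ
      ≈⟨ solve 1 (λ r → (r :* r :+ r) :* con (+ 4) :=
                  (r :+ r :+ con (+ 1)) :* (r :+ r :+ con (+ 1)) :- con (+ 1)) refl R₃ ⟩
    (R₃ + R₃ + 1#) * (R₃ + R₃ + 1#) - 1#        ≈⟨ +-congʳ (*-cong 2R₃+1≈√5 2R₃+1≈√5) ⟩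
    √5 * √5 - 1#                                ≈⟨ +-congʳ √5²≈5 ⟩
    ι (+ 5) - 1#                                ≈⟨ solve 1 (λ x → con (+ 1) :+ x :- con (+ 1) := con (+ 1) :* x)
                                                     refl (ι (+ 4)) ⟩
    1# * ι (+ 4)                                ∎)

  0<R₃ : 0# < R₃
  0<R₃ with 0≤R₃
  ... | inj₁ 0<R₃ = 0<R₃
  ... | inj₂ 0≈R₃ = contradiction 0<1 (≤⇒≯ (≤-resp refl (trans
    (+-cong (sym 0≈R₃) (sym 0≈R₃)) (+-identityʳ 0#)) 1≤R₃+R₃))

  r₃≈-R₃² : r₃ ≈ - (R₃ * R₃)
  r₃≈-R₃² = begin-equality
    R₃ - 1#                  ≈⟨ +-congˡ (-‿cong R₃²+R₃≈1) ⟨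
    R₃ - (R₃ * R₃ + R₃)      ≈⟨ solve 1 (λ r → r :- (r :* r :+ r) := :- (r :* r)) refl R₃ ⟩
    - (R₃ * R₃)              ∎

  r₃<0 : r₃ < 0#
  r₃<0 = <-respˡ-≈ (sym r₃≈-R₃²) (0<⇒-<0 (*-pos 0<R₃ 0<R₃))

  R₃*[R₃+1]≈1 : R₃ * (R₃ + 1#) ≈ 1#
  R₃*[R₃+1]≈1 = trans (trans (distribˡ R₃ R₃ 1#) (+-congˡ (*-identityʳ R₃))) R₃²+R₃≈1

  [R₃+1]⁻¹≈R₃ : (R₃ + 1#) ⁻¹ ≈ R₃
  [R₃+1]⁻¹≈R₃ = sym (⁻¹-unique (trans (*-comm _ R₃) R₃*[R₃+1]≈1))

  R₃⁻¹≈R₃+1 : R₃ ⁻¹ ≈ R₃ + 1#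
  R₃⁻¹≈R₃+1 = sym (⁻¹-unique R₃*[R₃+1]≈1)

  r₃*-[R₃+2]≈1 : r₃ * - (R₃ + 1# + 1#) ≈ 1#
  r₃*-[R₃+2]≈1 = begin-equality
    (R₃ - 1#) * - (R₃ + 1# + 1#)
      ≈⟨ solve 1 (λ r → (r :- con (+ 1)) :* (:- (r :+ con (+ 1) :+ con (+ 1))) :=
                  con (+ 2) :- (r :* r :+ r)) refl R₃ ⟩
    (1# + 1#) - (R₃ * R₃ + R₃)     ≈⟨ +-congˡ (-‿cong R₃²+R₃≈1) ⟩
    (1# + 1#) - 1#                 ≈⟨ x+y-y≈x 1# 1# ⟩
    1#                             ∎

  r₃⁻¹≈-[R₃+2] : r₃ ⁻¹ ≈ - (R₃ + 1# + 1#)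
  r₃⁻¹≈-[R₃+2] = sym (⁻¹-unique r₃*-[R₃+2]≈1)

  [R₃+2]⁻¹≈-r₃ : (R₃ + 1# + 1#) ⁻¹ ≈ - r₃
  [R₃+2]⁻¹≈-r₃ = sym (⁻¹-unique (trans
    (solve 2 (λ x y → x :* (:- y) := y :* (:- x)) refl (R₃ + 1# + 1#) r₃) r₃*-[R₃+2]≈1))

  -- The common image r₃ ≤ t ≤ R₃ of all branches with positive index.
  Window : Pred Carrier 0ℓ
  Window t = r₃ ≤ t × t ≤ R₃

  0<r₃+K : ∀ k → 0# < r₃ + K k
  0<r₃+K k = <-respʳ-≈
    (solve 2 (λ r x → r :+ (con (+ 1) :+ x) := r :- con (+ 1) :+ (con (+ 1) :+ (con (+ 1) :+ x))) refl R₃ (k · 1#))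
    (≤-pos 0≤R₃ (0<[1+n]·1 k))

  0<r₃+K+1 : ∀ k → 0# < r₃ + K k + 1#
  0<r₃+K+1 k = ≤-pos (inj₁ (0<r₃+K k)) 0<1

  J⁺⇒<0 : ∀ k {y} → J⁺ (2 ℕ.+ k) y → y < 0#
  J⁺⇒<0 k (_ , upper) = ≤-<-trans upper (0<⇒-<0 (⁻¹-pos (0<r₃+K+1 k)))

  private
    -y⁻¹ : ∀ {y} → y < 0# → (- y) ⁻¹ ≈ - y ⁻¹
    -y⁻¹ y<0 = ⁻¹-neg (<0⇒≉0 y<0)

    ≤-neg-swap : ∀ {x y} → x ≤ - y → y ≤ - x
    ≤-neg-swap {x} {y} x≤-y = ≤-resp (-‿involutive y) refl (neg-mono-≤ x≤-y)

    -≤-swap : ∀ {x y} → - x ≤ y → - y ≤ x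
    -≤-swap {x} {y} -x≤y = ≤-resp refl (-‿involutive x) (neg-mono-≤ -x≤y)

    ⁻¹-≤-swap : ∀ {x y} → 0# < x → x ⁻¹ ≤ y → y ⁻¹ ≤ x
    ⁻¹-≤-swap 0<x x⁻¹≤y = ≤-resp refl (⁻¹-involutive (0<⇒≉0 0<x)) (⁻¹-anti-≤ (⁻¹-pos 0<x) x⁻¹≤y)

    ≤-⁻¹-swap : ∀ {x y} → 0# < x → 0# < y → x ≤ y ⁻¹ → y ≤ x ⁻¹
    ≤-⁻¹-swap 0<x 0<y x≤y⁻¹ = ≤-resp (⁻¹-involutive (0<⇒≉0 0<y)) refl (⁻¹-anti-≤ 0<x x≤y⁻¹)

  -- Reciprocals reverse the order on positive numbers such as -y, so with m = 2 + k the end points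
  -- of J_m say r₃ + m ≤ -1/y ≤ r₃ + m + 1 = R₃ + m.
  J⁺⇒Window : ∀ k {y} → J⁺ (2 ℕ.+ k) y → Window (branch (+ (2 ℕ.+ k)) y)
  J⁺⇒Window k {y} y∈J@(lower , upper) =
      ≤-by-difference (solve 3 (λ r x z → z :- (r :+ x) := z :- x :- r) refl r₃ (K k) (- y ⁻¹))
        (≤-resp refl (-y⁻¹ y<0) (≤-⁻¹-swap 0<-y (0<r₃+K k) (-≤-swap lower)))
    , ≤-by-difference (solve 3 (λ R x z → R :- con (+ 1) :+ x :+ con (+ 1) :- z := R :- (z :- x)) refl R₃ (K k) (- y ⁻¹))
        (≤-resp (-y⁻¹ y<0) refl (⁻¹-≤-swap (0<r₃+K+1 k) (≤-neg-swap upper)))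
    where
    y<0 : y < 0#
    y<0 = J⁺⇒<0 k y∈J
    0<-y : 0# < - y
    0<-y = x<0⇒0<-x y<0

  -- The sign hypothesis guards against y = 0, where the unspecified reciprocal could meet the
  -- window condition by accident.
  Window⇒J⁺ : ∀ k {y} → y < 0# → Window (branch (+ (2 ℕ.+ k)) y) → J⁺ (2 ℕ.+ k) y
  Window⇒J⁺ k {y} y<0 (lower , upper) =
      -≤-swap (≤-⁻¹-swap (0<r₃+K k) 0<-y
        (≤-by-difference (trans (solve 3 (λ r x z → z :- x :- r := z :- (r :+ x)) refl r₃ (K k) (- y ⁻¹))
                                (+-congʳ (sym (-y⁻¹ y<0)))) lower))
    , ≤-neg-swap (⁻¹-≤-swap 0<-y
        (≤-by-difference (trans (solve 3 (λ R x z → R :- (z :- x) := R :- con (+ 1) :+ x :+ con (+ 1) :- z) refl R₃ (K k) (- y ⁻¹))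
                                (+-congˡ (-‿cong (sym (-y⁻¹ y<0))))) upper))
    where
    0<-y : 0# < - y
    0<-y = x<0⇒0<-x y<0

  J⁺-≥ : ∀ m {c y} → 0# < c → c ≤ r₃ + ι (+ m) → J⁺ m y → - c ⁻¹ ≤ y
  J⁺-≥ m 0<c c≤ (lower , _) = ≤-trans (neg-mono-≤ (⁻¹-anti-≤ 0<c c≤)) lower

  private
    0<R₃+1 : 0# < R₃ + 1#
    0<R₃+1 = ≤-pos 0≤R₃ 0<1

  -- Left end points increase with the digit, and the one of J_2 is -1/(r₃ + 2) = -1/(R₃ + 1) = -R₃.
  J⁺⇒≥-R₃ : ∀ k {y} → J⁺ (2 ℕ.+ k) y → - R₃ ≤ y
  J⁺⇒≥-R₃ k y∈J = ≤-resp (-‿cong [R₃+1]⁻¹≈R₃) refl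
    (J⁺-≥ (2 ℕ.+ k) 0<R₃+1
      (≤-by-difference (solve 2 (λ r x → x :- con (+ 0) :=
          r :- con (+ 1) :+ (con (+ 1) :+ (con (+ 1) :+ x)) :- (r :+ con (+ 1))) refl R₃ (k · 1#))
        (·1-mono-≤ {0} {k} ℕ.z≤n)) y∈J)

  -- The left end point of J_3, which is also the right end point of J_2, is -1/(r₃ + 3) = -1/(R₃ +
  -- 2) = r₃.
  J⁺⇒≥r₃ : ∀ k {y} → J⁺ (3 ℕ.+ k) y → r₃ ≤ y
  J⁺⇒≥r₃ k y∈J = ≤-resp (trans (-‿cong [R₃+2]⁻¹≈-r₃) (-‿involutive r₃)) refl
    (J⁺-≥ (3 ℕ.+ k) (≤-pos (inj₁ 0<R₃+1) 0<1)
      (≤-by-difference (solve 2 (λ r x → x :- con (+ 0) :=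
          r :- con (+ 1) :+ (con (+ 1) :+ (con (+ 1) :+ (con (+ 1) :+ x))) :- (r :+ con (+ 1) :+ con (+ 1)))
          refl R₃ (k · 1#))
        (·1-mono-≤ {0} {k} ℕ.z≤n)) y∈J)

  J⁺₂⇒≤r₃ : ∀ {y} → J⁺ 2 y → y ≤ r₃
  J⁺₂⇒≤r₃ (_ , upper) = ≤-resp refl (begin-equality
    - (r₃ + ι (+ 2) + 1#) ⁻¹   ≈⟨ -‿cong (⁻¹-cong (solve 1 (λ r →
      r :- con (+ 1) :+ (con (+ 1) :+ (con (+ 1) :+ con (+ 0))) :+ con (+ 1) := r :+ con (+ 1) :+ con (+ 1)) refl R₃)) ⟩
    - (R₃ + 1# + 1#) ⁻¹        ≈⟨ -‿cong [R₃+2]⁻¹≈-r₃ ⟩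
    - (- r₃)                   ≈⟨ -‿involutive r₃ ⟩
    r₃                         ∎) upper

-- The branches for all digits: images, inverses, expansion.

module Branches (ℝ : CompleteOrderedField) where
  open RosenMap ℝ
  open Arithmetic ℝ
  open Inverses ℝ
  open GoldenRatio ℝ
  open RingProperties ring
  open import Relation.Binary.Reasoning.StrictPartialOrder
    (StrictTotalOrder.strictPartialOrder strictTotalOrder)

  -- `F m` is a conjunction of negations; matching on this view instead exposes the sign and the
  -- excess of the modulus over 2, and lets `sign m` and `𝔸` compute.
  data Digit : ℤ → Set where
    digit : ∀ s k → Digit (s ◃ (2 ℕ.+ k))

  F⇒Digit : ∀ {m} → F m → Digit m
  F⇒Digit {+ 0}             (m≢0 , _)       = contradiction ≡.refl m≢0
  F⇒Digit {+ 1}             (_ , m≢1 , _)   = contradiction ≡.refl m≢1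
  F⇒Digit {+ suc (suc k)}   _               = digit Sign.+ k
  F⇒Digit { -[1+ 0 ]}       (_ , _ , m≢-1)  = contradiction ≡.refl m≢-1
  F⇒Digit { -[1+ suc k ]}   _               = digit Sign.- k

  Digit⇒F : ∀ s k → F (s ◃ (2 ℕ.+ k))
  Digit⇒F Sign.+ k = (λ ()) , (λ ()) , (λ ())
  Digit⇒F Sign.- k = (λ ()) , (λ ()) , (λ ())

  Image : ℤ → Pred Carrier 0ℓ
  Image m t = Window (σ (sign m) t)

  Window-resp : ∀ {x y} → x ≈ y → Window x → Window y
  Window-resp x≈y (l , u) = ≤-resp refl x≈y l , ≤-resp x≈y refl u

  branch-cong : ∀ m {x y} → x ≈ y → branch m x ≈ branch m y
  branch-cong m x≈y = +-congʳ (-‿cong (⁻¹-cong x≈y))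

  J⁺-resp : ∀ n {x y} → x ≈ y → J⁺ n x → J⁺ n y
  J⁺-resp n x≈y (l , u) = ≤-resp refl x≈y l , ≤-resp x≈y refl u

  J-resp : ∀ m {x y} → x ≈ y → J m x → J m y
  J-resp (+ n)    x≈y = J⁺-resp n x≈y
  J-resp -[1+ n ] x≈y = J⁺-resp (suc n) (-‿cong x≈y)

  -- The transfer from positive to negative digits. It is restricted to x ≉ 0 because the reciprocal
  -- of 0 is unspecified.
  branch-odd : ∀ n {x} → ¬ x ≈ 0# → branch (+ suc n) (- x) ≈ - branch -[1+ n ] x
  branch-odd n {x} x≉0 = begin-equality
    - (- x) ⁻¹ - ι (+ suc n)              ≈⟨ +-congʳ (-‿cong (⁻¹-neg x≉0)) ⟩
    - (- x ⁻¹) - ι (+ suc n)              ≈⟨ -‿+-comm (- x ⁻¹) (ι (+ suc n)) ⟩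
    - (- x ⁻¹ + ι (+ suc n))              ≈⟨ -‿cong (+-congˡ (-‿involutive _)) ⟨
    - (- x ⁻¹ - - ι (+ suc n))            ∎

  J⇒<0 : ∀ {m x} → F m → J m x → σ (sign m) x < 0#
  J⇒<0 m∈F with F⇒Digit m∈F
  ... | digit Sign.+ k = J⁺⇒<0 k
  ... | digit Sign.- k = J⁺⇒<0 k

  J⇒≉0 : ∀ {m x} → F m → J m x → ¬ x ≈ 0#
  J⇒≉0 {m} m∈F x∈J = σ-≉0 (sign m) (J⇒<0 m∈F x∈J)

  J⇒Image : ∀ {m x} → F m → J m x → Image m (branch m x)
  J⇒Image m∈F x∈J with F⇒Digit m∈F
  ... | digit Sign.+ k = J⁺⇒Window k x∈J
  ... | digit Sign.- k = Window-resp (branch-odd (suc k) (J⇒≉0 m∈F x∈J)) (J⁺⇒Window k x∈J)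

  Image⇒J : ∀ {m x} → F m → σ (sign m) x < 0# → Image m (branch m x) → J m x
  Image⇒J m∈F σx<0 w with F⇒Digit m∈F
  ... | digit Sign.+ k = Window⇒J⁺ k σx<0 w
  ... | digit Sign.- k = Window⇒J⁺ k σx<0
        (Window-resp (sym (branch-odd (suc k) (σ-≉0 Sign.- σx<0))) w)

  private
    ≥-R₃⇒-≤R₃ : ∀ {x} → - R₃ ≤ x → - x ≤ R₃
    ≥-R₃⇒-≤R₃ -R₃≤x = ≤-resp refl (-‿involutive R₃) (neg-mono-≤ -R₃≤x)

    ≥-R₃⇒Window- : ∀ {x} → x < 0# → - R₃ ≤ x → Window (- x)
    ≥-R₃⇒Window- x<0 -R₃≤x =
      ≤-trans r₃≤0 (inj₁ (x<0⇒0<-x x<0)) , ≥-R₃⇒-≤R₃ -R₃≤x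

    ≥r₃⇒Window : ∀ {x} → x < 0# → r₃ ≤ x → Window x
    ≥r₃⇒Window x<0 r₃≤x = r₃≤x , ≤-trans (inj₁ x<0) 0≤R₃

  J⇒I : ∀ {m x} → F m → J m x → I x
  J⇒I m∈F x∈J with F⇒Digit m∈F
  ... | digit Sign.+ k = J⁺⇒≥-R₃ k x∈J , ≤-trans (inj₁ (J⁺⇒<0 k x∈J)) 0≤R₃
  ... | digit Sign.- k = ≤-resp refl (-‿involutive _) (proj₁ -x∈I)
                       , ≤-resp (-‿involutive _) refl (proj₂ -x∈I)
    where -x∈I = I-neg (J⁺⇒≥-R₃ k x∈J , ≤-trans (inj₁ (J⁺⇒<0 k x∈J)) 0≤R₃)

  -- For positive m the image is [r₃, R₃]. It contains J_n for n ≥ 3, which lies in [r₃, 0), and J_n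
  -- for n < 0, which lies in (0, R₃]; the digit 2, whose interval lies to the left of r₃, is the
  -- one that `𝔸` forbids. Negative m is the mirror image.
  admissible⇒Image : ∀ {m n x} → F m → F n → 𝔸 m n ≡ 1 → J n x → Image m x
  admissible⇒Image m∈F n∈F 𝔸≡1 x∈J with F⇒Digit m∈F | F⇒Digit n∈F
  ... | digit Sign.+ _ | digit Sign.+ zero    = contradiction 𝔸≡1 λ ()
  ... | digit Sign.+ _ | digit Sign.+ (suc l) = ≥r₃⇒Window (J⁺⇒<0 (suc l) x∈J) (J⁺⇒≥r₃ l x∈J)
  ... | digit Sign.+ _ | digit Sign.- l       = Window-resp (-‿involutive _)
                                                  (≥-R₃⇒Window- (J⁺⇒<0 l x∈J) (J⁺⇒≥-R₃ l x∈J))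
  ... | digit Sign.- _ | digit Sign.+ l       = ≥-R₃⇒Window- (J⁺⇒<0 l x∈J) (J⁺⇒≥-R₃ l x∈J)
  ... | digit Sign.- _ | digit Sign.- zero    = contradiction 𝔸≡1 λ ()
  ... | digit Sign.- _ | digit Sign.- (suc l) = ≥r₃⇒Window (J⁺⇒<0 (suc l) x∈J) (J⁺⇒≥r₃ l x∈J)

  inverseBranch : ℤ → Carrier → Carrier
  inverseBranch m t = - (t + ι m) ⁻¹

  -- The pole t = -m lies outside the image, since already r₃ + 2 = R₃ + 1 is positive.
  inverseBranch-pole : ∀ {m t} → F m → Image m t → 0# < σ (sign m) (t + ι m)
  inverseBranch-pole m∈F (r₃≤σt , _) with F⇒Digit m∈F
  ... | digit Sign.+ k = <-≤-trans (0<r₃+K k) (+-monoˡ-≤ (K k) r₃≤σt)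
  ... | digit Sign.- k = <-≤-trans (0<r₃+K k) (≤-resp refl
          (solve 2 (λ t K → :- t :+ K := :- (t :- K)) refl _ (K k)) (+-monoˡ-≤ (K k) r₃≤σt))

  branch∘inverseBranch : ∀ {m t} → F m → Image m t → branch m (inverseBranch m t) ≈ t
  branch∘inverseBranch {m} {t} m∈F w = begin-equality
    - (- u ⁻¹) ⁻¹ - ι m         ≈⟨ +-congʳ (-‿cong (⁻¹-cong (⁻¹-neg u≉0))) ⟨
    - ((- u) ⁻¹) ⁻¹ - ι m       ≈⟨ +-congʳ (-‿cong (⁻¹-involutive -u≉0)) ⟩
    - (- u) - ι m               ≈⟨ +-congʳ (-‿involutive u) ⟩
    (t + ι m) - ι m             ≈⟨ x+y-y≈x t (ι m) ⟩
    t                           ∎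
    where
    u : Carrier
    u = t + ι m
    0<σu : 0# < σ (sign m) u
    0<σu = inverseBranch-pole m∈F w
    -u≉0 : ¬ - u ≈ 0#
    -u≉0 -u≈0 = 0<⇒≉0 0<σu (vanish (sign m))
      where
      u≈0 : u ≈ 0#
      u≈0 = trans (sym (-‿involutive u)) (trans (-‿cong -u≈0) -0#≈0#)
      vanish : ∀ s → σ s u ≈ 0#
      vanish Sign.+ = u≈0
      vanish Sign.- = -u≈0
    u≉0 : ¬ u ≈ 0#
    u≉0 u≈0 = -u≉0 (trans (-‿cong u≈0) -0#≈0#)

  inverseBranch∈J : ∀ {m t} → F m → Image m t → J m (inverseBranch m t)
  inverseBranch∈J {m} {t} m∈F w = Image⇒J m∈F (below (sign m) (inverseBranch-pole m∈F w))
    (Window-resp (σ-cong (sign m) (sym (branch∘inverseBranch m∈F w))) w)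
    where
    below : ∀ s → 0# < σ s (t + ι m) → σ s (inverseBranch m t) < 0#
    below Sign.+ 0<u  = 0<⇒-<0 (⁻¹-pos 0<u)
    below Sign.- 0<-u = <-respˡ-≈ (-‿cong (⁻¹-neg (σ-≉0 Sign.+ u<0))) (0<⇒-<0 (⁻¹-pos 0<-u))
      where
      u<0 : t + ι m < 0#
      u<0 = <-respˡ-≈ (-‿involutive _) (0<⇒-<0 0<-u)

  *-monoˡ-≤ : ∀ {x y z} → 0# < z → x ≤ y → x * z ≤ y * z
  *-monoˡ-≤ 0<z (inj₁ x<y) = inj₁ (*-monoˡ-< 0<z x<y)
  *-monoˡ-≤ 0<z (inj₂ x≈y) = inj₂ (*-congʳ x≈y)

  -- Bounds the reciprocal of the difference quotient of a branch. Both points have the same sign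
  -- and moduli `p`, `q` at most R₃, so xy ≤ R₃²; since R₃² = 1 - R₃, the bound 2 R₃² ≤ 1 is just 1
  -- ≤ 2 R₃.
  J-product : ∀ {m x y} → F m → J m x → J m y → 0# < x * y × x * y + x * y ≤ 1#
  J-product {m} {x} {y} m∈F x∈J y∈J =
    <-respʳ-≈ (flip (sign m)) (*-pos 0<p 0<q) , ≤-trans (+-mono-≤ xy≤R₃² xy≤R₃²) 2R₃²≤1
    where
    p q : Carrier
    p = - σ (sign m) x
    q = - σ (sign m) y
    flip : ∀ s → - σ s x * - σ s y ≈ x * y
    flip Sign.+ = solve 2 (λ x y → :- x :* :- y := x :* y) refl x y
    flip Sign.- = *-cong (-‿involutive x) (-‿involutive y)
    0<p : 0# < p
    0<p = x<0⇒0<-x (J⇒<0 m∈F x∈J)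
    0<q : 0# < q
    0<q = x<0⇒0<-x (J⇒<0 m∈F y∈J)
    bound : ∀ s {z} → I z → - σ s z ≤ R₃
    bound Sign.+ (l , _) = ≥-R₃⇒-≤R₃ l
    bound Sign.- (_ , u) = ≤-resp (sym (-‿involutive _)) refl u
    +-mono-≤ : ∀ {u v w z} → u ≤ v → w ≤ z → u + w ≤ v + z
    +-mono-≤ u≤v w≤z = ≤-trans (+-monoˡ-≤ _ u≤v) (+-monoʳ-≤ _ w≤z)
    xy≤R₃² : x * y ≤ R₃ * R₃
    xy≤R₃² = ≤-resp (flip (sign m)) refl (≤-trans
      (*-monoˡ-≤ 0<q (bound (sign m) (J⇒I m∈F x∈J)))
      (≤-resp (*-comm q R₃) refl (*-monoˡ-≤ 0<R₃ (bound (sign m) (J⇒I m∈F y∈J)))))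
    2R₃²≤1 : R₃ * R₃ + R₃ * R₃ ≤ 1#
    2R₃²≤1 = ≤-by-difference (begin-equality
      (R₃ + R₃) - 1#
        ≈⟨ solve 1 (λ r → r :+ r :- con (+ 1) :=
             (r :* r :+ r) :+ (r :* r :+ r) :- con (+ 1) :- (r :* r :+ r :* r)) refl R₃ ⟩
      (R₃ * R₃ + R₃) + (R₃ * R₃ + R₃) - 1# - (R₃ * R₃ + R₃ * R₃)
        ≈⟨ +-congʳ (+-congʳ (+-cong R₃²+R₃≈1 R₃²+R₃≈1)) ⟩
      1# + 1# - 1# - (R₃ * R₃ + R₃ * R₃)
        ≈⟨ +-congʳ (x+y-y≈x 1# 1#) ⟩
      1# - (R₃ * R₃ + R₃ * R₃)  ∎) 1≤R₃+R₃

  -- The difference of the images is 1/x - 1/y = (y - x)/(xy), and 2xy ≤ 1. The factor 2 suffices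
  -- for uniqueness and gives strict monotonicity as well.
  branch-expanding : ∀ {m x y} → F m → J m x → J m y → x < y →
                     (y - x) + (y - x) ≤ branch m y - branch m x
  branch-expanding {m} {x} {y} m∈F x∈J y∈J x<y = ≤-resp
    (begin-equality
      (x * y + x * y) * d         ≈⟨ solve 2 (λ p d → (p :+ p) :* d := d :* p :+ d :* p) refl (x * y) d ⟩
      d * (x * y) + d * (x * y)   ≈⟨ +-cong d*xy d*xy ⟩
      (y - x) + (y - x)           ∎)
    (begin-equality
      1# * d                      ≈⟨ solve 3 (λ a b c → con (+ 1) :* (a :- b) := :- b :- c :- (:- a :- c))
                                       refl (x ⁻¹) (y ⁻¹) (ι m) ⟩
      branch m y - branch m x     ∎)
    (*-monoˡ-≤ 0<d (proj₂ (J-product m∈F x∈J y∈J)))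
    where
    d : Carrier
    d = x ⁻¹ - y ⁻¹
    d*xy : d * (x * y) ≈ y - x
    d*xy = begin-equality
      (x ⁻¹ - y ⁻¹) * (x * y)             ≈⟨ solve 4 (λ a b x y →
                                               (a :- b) :* (x :* y) := (x :* a) :* y :- (y :* b) :* x)
                                               refl (x ⁻¹) (y ⁻¹) x y ⟩
      (x * x ⁻¹) * y - (y * y ⁻¹) * x     ≈⟨ +-cong (*-congʳ (*-inverseʳ (J⇒≉0 m∈F x∈J)))
                                                    (-‿cong (*-congʳ (*-inverseʳ (J⇒≉0 m∈F y∈J)))) ⟩
      1# * y - 1# * x                     ≈⟨ +-cong (*-identityˡ y) (-‿cong (*-identityˡ x)) ⟩
      y - x                               ∎
    0<d : 0# < d
    0<d = *-cancelʳ-< (proj₁ (J-product m∈F x∈J y∈J)) (begin-strict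
      0# * (x * y)   ≈⟨ zeroˡ (x * y) ⟩
      0#             ≈⟨ -‿inverseʳ x ⟨
      x - x          <⟨ +-monoˡ-< (- x) x<y ⟩
      y - x          ≈⟨ d*xy ⟨
      d * (x * y)    ∎)

  branch-mono-< : ∀ {m x y} → F m → J m x → J m y → x < y → branch m x < branch m y
  branch-mono-< {m} {x} {y} m∈F x∈J y∈J x<y = <-by-difference (x-0≈x _)
    (<-≤-trans (≤-pos (inj₁ 0<y-x) 0<y-x) (branch-expanding m∈F x∈J y∈J x<y))
    where
    0<y-x : 0# < y - x
    0<y-x = <-respˡ-≈ (-‿inverseʳ x) (+-monoˡ-< (- x) x<y)
    x-0≈x : ∀ z → z - 0# ≈ z
    x-0≈x z = trans (+-congˡ -0#≈0#) (+-identityʳ z)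

  branch-mono-≤ : ∀ {m x y} → F m → J m x → J m y → x ≤ y → branch m x ≤ branch m y
  branch-mono-≤     m∈F x∈J y∈J (inj₁ x<y) = inj₁ (branch-mono-< m∈F x∈J y∈J x<y)
  branch-mono-≤ {m} m∈F x∈J y∈J (inj₂ x≈y) = inj₂ (branch-cong m x≈y)

  inverseBranch-mono-≤ : ∀ {m t u} → F m → Image m t → Image m u → t ≤ u →
                         inverseBranch m t ≤ inverseBranch m u
  inverseBranch-mono-≤ m∈F t∈ u∈ t≤u = ≮⇒≥ λ gu<gt → ≤⇒≯ t≤u
    (<-respˡ-≈ (branch∘inverseBranch m∈F u∈) (<-respʳ-≈ (branch∘inverseBranch m∈F t∈)
      (branch-mono-< m∈F (inverseBranch∈J m∈F u∈) (inverseBranch∈J m∈F t∈) gu<gt)))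

-- Uniqueness of the point with a given expansion.

module Expansions (ℝ : CompleteOrderedField) where
  open RosenMap ℝ
  open Arithmetic ℝ
  open Inverses ℝ
  open GoldenRatio ℝ
  open Branches ℝ
  open RingProperties ring

  -- `Nested` on bare reals: for digits in `F`, membership in `I` follows from the condition at l =
  -- 0.
  Path : (ℕ → ℤ) → Pred Carrier 0ℓ
  Path ξ x = ∀ l → J (ξ l) (branches ξ l x)

  -- `branches` puts the newest branch outermost, whereas arguments about tails have to split off
  -- the oldest one.
  branches-shift : ∀ ξ l x → branches ξ (suc l) x ≡ branches (τ ξ) l (branch (ξ 0) x)
  branches-shift ξ zero    x = ≡.refl
  branches-shift ξ (suc l) x = ≡.cong (branch (ξ (suc l))) (branches-shift ξ l x)

  branches-cong : ∀ ξ l {x y} → x ≈ y → branches ξ l x ≈ branches ξ l y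
  branches-cong ξ zero    x≈y = x≈y
  branches-cong ξ (suc l) x≈y = branch-cong (ξ l) (branches-cong ξ l x≈y)

  branches-ext : ∀ {ξ η} → ξ ≗ η → ∀ l x → branches ξ l x ≡ branches η l x
  branches-ext ξ≗η zero    x = ≡.refl
  branches-ext ξ≗η (suc l) x = ≡.cong₂ branch (ξ≗η l) (branches-ext ξ≗η l x)

  Path-resp : ∀ {ξ x y} → x ≈ y → Path ξ x → Path ξ y
  Path-resp {ξ} x≈y path l = J-resp (ξ l) (branches-cong ξ l x≈y) (path l)

  Path-ext : ∀ {ξ η x} → ξ ≗ η → Path ξ x → Path η x
  Path-ext {x = x} ξ≗η path l = ≡.subst₂ J (ξ≗η l) (branches-ext ξ≗η l x) (path l)

  Path-tail : ∀ {ξ x} → Path ξ x → Path (τ ξ) (branch (ξ 0) x)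
  Path-tail {ξ} {x} path l = ≡.subst (J (ξ (suc l))) (branches-shift ξ l x) (path (suc l))

  Admissible-tail : ∀ {ξ} → Admissible ξ → Admissible (τ ξ)
  Admissible-tail (ξ∈F , 𝔸≡1) = ξ∈F ∘ suc , 𝔸≡1 ∘ suc

  τ^-lookup : ∀ n ξ i → τ^ n ξ i ≡ ξ (n ℕ.+ i)
  τ^-lookup zero    ξ i = ≡.refl
  τ^-lookup (suc n) ξ i = ≡.trans (τ^-lookup n ξ (suc i)) (≡.cong ξ (ℕ.+-suc n i))

  Admissible-τ^ : ∀ n {ξ} → Admissible ξ → Admissible (τ^ n ξ)
  Admissible-τ^ zero    adm = adm
  Admissible-τ^ (suc n) adm = Admissible-tail (Admissible-τ^ n adm)

  Path-τ^ : ∀ n {ξ x} → Path ξ x → Path (τ^ n ξ) (branches ξ n x)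
  Path-τ^ zero            path = path
  Path-τ^ (suc n) {ξ} {x} path =
    ≡.subst (λ m → Path (τ^ (suc n) ξ) (branch m (branches ξ n x)))
      (≡.trans (τ^-lookup n ξ 0) (≡.cong ξ (ℕ.+-identityʳ n)))
      (Path-tail (Path-τ^ n path))

  -- The set of distances between distinct points with a common expansion is
  -- bounded and closed under (at least) doubling, hence empty.
  Gap : Pred Carrier 0ℓ
  Gap d = ∃[ ξ ] ∃[ x ] ∃[ y ]
    (∀ i → F (ξ i)) × Path ξ x × Path ξ y × x < y × d ≈ y - x

  -- The images of the two points share the expansion τ ξ rather than ξ, which is why `Gap`
  -- quantifies over the sequence.
  Gap-doubles : ∀ {d} → Gap d → ∃[ d′ ] Gap d′ × d + d ≤ d′
  Gap-doubles (ξ , x , y , ξ∈F , x-path , y-path , x<y , d≈y-x) =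
      branch (ξ 0) y - branch (ξ 0) x
    , ( τ ξ , branch (ξ 0) x , branch (ξ 0) y , ξ∈F ∘ suc , Path-tail x-path , Path-tail y-path
      , branch-mono-< (ξ∈F 0) (x-path 0) (y-path 0) x<y , refl )
    , ≤-resp (sym (+-cong d≈y-x d≈y-x)) refl (branch-expanding (ξ∈F 0) (x-path 0) (y-path 0) x<y)

  Gap-pos : ∀ {d} → Gap d → 0# < d
  Gap-pos (_ , x , _ , _ , _ , _ , x<y , d≈y-x) =
    <-respʳ-≈ (sym d≈y-x) (<-respˡ-≈ (-‿inverseʳ x) (+-monoˡ-< (- x) x<y))

  Gap-bounded : ∀ {d} → Gap d → d ≤ R₃ - - R₃
  Gap-bounded (_ , _ , _ , ξ∈F , x-path , y-path , _ , d≈y-x) = ≤-resp (sym d≈y-x) refl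
    (≤-trans (+-monoˡ-≤ _ (proj₂ (J⇒I (ξ∈F 0) (y-path 0))))
             (+-monoʳ-≤ R₃ (neg-mono-≤ (proj₁ (J⇒I (ξ∈F 0) (x-path 0))))))

  Gap-empty : ∀ {d} → ¬ Gap d
  Gap-empty {d} gap
    with s , upper , approx ← supremum Gap (d , gap) (R₃ - - R₃ , Gap-bounded)
    -- The tolerance is the gap d itself: s - d < e and 2e ≤ s give s < 2d, against 2d ≤ s.
    with e , gap′ , s-d<e ← approx {s - d}
           (<-respʳ-≈ (+-identityʳ s) (+-monoʳ-< s (0<⇒-<0 (Gap-pos gap))))
    = <-irrefl refl (<-≤-trans
        (<-by-difference (rearrange s d)
          (<-≤-trans (+-mono-< s-d<e s-d<e) (doubled≤s gap′)))
        (doubled≤s gap))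
    where
    rearrange : ∀ s d → s - ((s - d) + (s - d)) ≈ (d + d) - s
    rearrange = solve 2 (λ s d → s :- (s :- d :+ (s :- d)) := d :+ d :- s) refl
    doubled≤s : ∀ {e} → Gap e → e + e ≤ s
    doubled≤s gap-e = let _ , gap′ , 2e≤e′ = Gap-doubles gap-e in ≤-trans 2e≤e′ (upper gap′)

  Path-unique : ∀ {ξ x y} → (∀ i → F (ξ i)) → Path ξ x → Path ξ y → x ≈ y
  Path-unique {ξ} {x} {y} ξ∈F x-path y-path with compare x y
  ... | tri≈ _ x≈y _ = x≈y
  ... | tri< x<y _ _ = contradiction (ξ , x , y , ξ∈F , x-path , y-path , x<y , refl) Gap-empty
  ... | tri> _ _ y<x = contradiction (ξ , y , x , ξ∈F , y-path , x-path , y<x , refl) Gap-empty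

  -- Existence of a point with a given admissible expansion.

  Image-min Image-max : ℤ → Carrier
  Image-min (+ _)    = r₃
  Image-min -[1+ _ ] = - R₃
  Image-max (+ _)    = R₃
  Image-max -[1+ _ ] = - r₃

  r₃≤R₃ : r₃ ≤ R₃
  r₃≤R₃ = ≤-trans r₃≤0 0≤R₃

  Image-min∈Image : ∀ m → Image m (Image-min m)
  Image-min∈Image (+ _)    = inj₂ refl , r₃≤R₃
  Image-min∈Image -[1+ _ ] = ≤-resp refl (sym (-‿involutive R₃)) r₃≤R₃ , inj₂ (-‿involutive R₃)

  Image-max∈Image : ∀ m → Image m (Image-max m)
  Image-max∈Image (+ _)    = r₃≤R₃ , inj₂ refl
  Image-max∈Image -[1+ _ ] = inj₂ (sym (-‿involutive r₃)) , ≤-resp (sym (-‿involutive r₃)) refl r₃≤R₃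

  Image-min-least : ∀ m {t} → Image m t → Image-min m ≤ t
  Image-min-least (+ _)    (l , _) = l
  Image-min-least -[1+ _ ] (_ , u) = ≤-resp refl (-‿involutive _) (neg-mono-≤ u)

  Image-max-greatest : ∀ m {t} → Image m t → t ≤ Image-max m
  Image-max-greatest (+ _)    (_ , u) = u
  Image-max-greatest -[1+ _ ] (l , _) = ≤-resp (-‿involutive _) refl (neg-mono-≤ l)

  J-min J-max : ℤ → Carrier
  J-min m = inverseBranch m (Image-min m)
  J-max m = inverseBranch m (Image-max m)

  J-min∈J : ∀ {m} → F m → J m (J-min m)
  J-min∈J {m} m∈F = inverseBranch∈J m∈F (Image-min∈Image m)

  J-max∈J : ∀ {m} → F m → J m (J-max m)
  J-max∈J {m} m∈F = inverseBranch∈J m∈F (Image-max∈Image m)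

  J-min-least : ∀ {m x} → F m → J m x → J-min m ≤ x
  J-min-least {m} m∈F x∈J = ≮⇒≥ λ x<min → ≤⇒≯ (Image-min-least m (J⇒Image m∈F x∈J))
    (<-respʳ-≈ (branch∘inverseBranch m∈F (Image-min∈Image m))
      (branch-mono-< m∈F x∈J (J-min∈J m∈F) x<min))

  J-max-greatest : ∀ {m x} → F m → J m x → x ≤ J-max m
  J-max-greatest {m} m∈F x∈J = ≮⇒≥ λ max<x → ≤⇒≯ (Image-max-greatest m (J⇒Image m∈F x∈J))
    (<-respˡ-≈ (branch∘inverseBranch m∈F (Image-max∈Image m))
      (branch-mono-< m∈F (J-max∈J m∈F) x∈J max<x))

  J-convex : ∀ m {u v x} → J m u → J m v → u ≤ x → x ≤ v → J m x
  J-convex (+ _)    (l , _) (_ , u) u≤x x≤v = ≤-trans l u≤x , ≤-trans x≤v u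
  J-convex -[1+ _ ] (_ , u) (l , _) u≤x x≤v =
    ≤-trans l (neg-mono-≤ x≤v) , ≤-trans (neg-mono-≤ u≤x) u

  -- For e = J-min and e = J-max these are the end points of the interval of
  -- points whose expansion starts with ξ 0, …, ξ n.
  pullback : (ℤ → Carrier) → ℕ → (ℕ → ℤ) → Carrier
  pullback e zero    ξ = e (ξ 0)
  pullback e (suc n) ξ = inverseBranch (ξ 0) (pullback e n (τ ξ))

  module _ {e : ℤ → Carrier} (e∈J : ∀ {m} → F m → J m (e m)) where
    pullback∈J : ∀ n {ξ} → Admissible ξ → J (ξ 0) (pullback e n ξ)
    pullback-tail∈Image : ∀ n {ξ} → Admissible ξ → Image (ξ 0) (pullback e n (τ ξ))

    pullback∈J zero    (ξ∈F , _)     = e∈J (ξ∈F 0)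
    pullback∈J (suc n) adm@(ξ∈F , _) = inverseBranch∈J (ξ∈F 0) (pullback-tail∈Image n adm)

    pullback-tail∈Image n adm@(ξ∈F , 𝔸≡1) =
      admissible⇒Image (ξ∈F 0) (ξ∈F 1) (𝔸≡1 0) (pullback∈J n (Admissible-tail adm))

  -- The two depths are independent, because the supremum of all lower end points has to stay below
  -- each upper one. At depth 0 the end points of J are extremal; deeper, the common inverse branch
  -- is monotone.
  pullback-min≤max : ∀ m n {ξ} → Admissible ξ → pullback J-min m ξ ≤ pullback J-max n ξ
  pullback-min≤max zero    n    adm@(ξ∈F , _) = J-min-least (ξ∈F 0) (pullback∈J J-max∈J n adm)
  pullback-min≤max (suc m) zero adm@(ξ∈F , _) =
    J-max-greatest (ξ∈F 0) (pullback∈J J-min∈J (suc m) adm)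
  pullback-min≤max (suc m) (suc n) adm@(ξ∈F , _) =
    inverseBranch-mono-≤ (ξ∈F 0) (pullback-tail∈Image J-min∈J m adm) (pullback-tail∈Image J-max∈J n adm)
      (pullback-min≤max m n (Admissible-tail adm))

  -- The first branch is monotone and undoes the outermost inverse branch, so bounds at depth n + 1
  -- for ξ become bounds at depth n for τ ξ.
  between⇒Path : ∀ {ξ x} → Admissible ξ →
                 (∀ n → pullback J-min n ξ ≤ x) → (∀ n → x ≤ pullback J-max n ξ) → Path ξ x
  between⇒Path {ξ} adm@(ξ∈F , _) min≤x x≤max zero =
    J-convex (ξ 0) (J-min∈J (ξ∈F 0)) (J-max∈J (ξ∈F 0)) (min≤x 0) (x≤max 0)
  between⇒Path {ξ} {x} adm@(ξ∈F , _) min≤x x≤max (suc l) =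
    ≡.subst (J (ξ (suc l))) (≡.sym (branches-shift ξ l x))
      (between⇒Path (Admissible-tail adm)
        (λ n → ≤-resp (branch∘inverseBranch (ξ∈F 0) (pullback-tail∈Image J-min∈J n adm)) refl
          (branch-mono-≤ (ξ∈F 0) (pullback∈J J-min∈J (suc n) adm) x∈J (min≤x (suc n))))
        (λ n → ≤-resp refl (branch∘inverseBranch (ξ∈F 0) (pullback-tail∈Image J-max∈J n adm))
          (branch-mono-≤ (ξ∈F 0) x∈J (pullback∈J J-max∈J (suc n) adm) (x≤max (suc n)))) l)
    where
    x∈J : J (ξ 0) x
    x∈J = between⇒Path adm min≤x x≤max zero

  opaque
    Path-exists : ∀ {ξ} → Admissible ξ → ∃[ x ] Path ξ x
    Path-exists {ξ} adm
      with s , upper , approx ← supremum (λ y → ∃[ n ] y ≈ pullback J-min n ξ)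
             (pullback J-min 0 ξ , 0 , refl)
             (pullback J-max 0 ξ , λ (n , y≈) → ≤-resp (sym y≈) refl (pullback-min≤max n 0 adm))
      = s , between⇒Path adm (λ n → upper (n , refl)) (λ n → ≮⇒≥ λ max<s →
          let _ , (m , y≈) , max<y = approx max<s
          in ≤⇒≯ (pullback-min≤max m n adm) (<-respʳ-≈ y≈ max<y))

-- Expansions of the end points ±r₃ and ±R₃.

module Boundary (ℝ : CompleteOrderedField) where
  open RosenMap ℝ
  open Arithmetic ℝ
  open Inverses ℝ
  open GoldenRatio ℝ
  open Branches ℝ
  open Expansions ℝ
  open RingProperties ring
  open import Relation.Binary.Reasoning.StrictPartialOrder
    (StrictTotalOrder.strictPartialOrder strictTotalOrder)

  branch-r₃ : ∀ k → branch (+ (2 ℕ.+ k)) r₃ ≈ R₃ - k · 1#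
  branch-r₃ k = begin-equality
    - r₃ ⁻¹ - K k                      ≈⟨ +-congʳ (-‿cong r₃⁻¹≈-[R₃+2]) ⟩
    - (- (R₃ + 1# + 1#)) - K k         ≈⟨ solve 2 (λ R x →
      (:- (:- (R :+ con (+ 1) :+ con (+ 1)))) :- (con (+ 1) :+ (con (+ 1) :+ x)) := R :- x) refl R₃ (k · 1#) ⟩
    R₃ - k · 1#                        ∎

  branch--R₃ : ∀ k → branch (+ (2 ℕ.+ k)) (- R₃) ≈ r₃ - k · 1#
  branch--R₃ k = begin-equality
    - (- R₃) ⁻¹ - K k                  ≈⟨ +-congʳ (-‿cong (⁻¹-neg (0<⇒≉0 0<R₃))) ⟩
    - (- R₃ ⁻¹) - K k                  ≈⟨ +-congʳ (-‿cong (-‿cong R₃⁻¹≈R₃+1)) ⟩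
    - (- (R₃ + 1#)) - K k              ≈⟨ solve 2 (λ R x →
      (:- (:- (R :+ con (+ 1)))) :- (con (+ 1) :+ (con (+ 1) :+ x)) := R :- con (+ 1) :- x) refl R₃ (k · 1#) ⟩
    r₃ - k · 1#                        ∎

  x-0≈x : ∀ x → x - 0 · 1# ≈ x
  x-0≈x x = trans (+-congˡ -0#≈0#) (+-identityʳ x)

  -- The image R₃ - k of r₃ drops below r₃ = R₃ - 1 as soon as k ≥ 2.
  J⁺∋r₃ : ∀ k → J⁺ (2 ℕ.+ k) r₃ → k ≡ 0 ⊎ k ≡ 1
  J⁺∋r₃ zero          _    = inj₁ ≡.refl
  J⁺∋r₃ (suc zero)    _    = inj₂ ≡.refl
  J⁺∋r₃ (suc (suc k)) r₃∈J = contradiction (0<[1+n]·1 k) (≤⇒≯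
    (≤-by-difference (solve 2 (λ R x →
        R :- (con (+ 1) :+ (con (+ 1) :+ x)) :- (R :- con (+ 1)) := con (+ 0) :- (con (+ 1) :+ x)) refl R₃ (k · 1#))
      (≤-resp refl (branch-r₃ (2 ℕ.+ k)) (proj₁ (J⁺⇒Window (2 ℕ.+ k) r₃∈J)))))

  J⁺∋-R₃ : ∀ k → J⁺ (2 ℕ.+ k) (- R₃) → k ≡ 0
  J⁺∋-R₃ zero    _     = ≡.refl
  J⁺∋-R₃ (suc k) -R₃∈J = contradiction (0<[1+n]·1 k) (≤⇒≯
    (≤-by-difference (solve 2 (λ r x → r :- x :- r := con (+ 0) :- x) refl r₃ (suc k · 1#))
      (≤-resp refl (branch--R₃ (suc k)) (proj₁ (J⁺⇒Window (suc k) -R₃∈J)))))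

  private
    ¬-r₃<0 : ¬ - r₃ < 0#
    ¬-r₃<0 -r₃<0 = <-asym r₃<0 (-0< -r₃<0)

    r₃-odd : ∀ n {y} → branch (+ suc n) r₃ ≈ y → branch -[1+ n ] (- r₃) ≈ - y
    r₃-odd n eq = trans (sym (-‿involutive _)) (-‿cong (trans (sym (branch-odd n -r₃≉0))
      (trans (branch-cong (+ suc n) (-‿involutive r₃)) eq)))
      where
      -r₃≉0 : ¬ - r₃ ≈ 0#
      -r₃≉0 = 0<⇒≉0 (x<0⇒0<-x r₃<0)

    R₃-odd : ∀ n {y} → branch (+ suc n) (- R₃) ≈ y → branch -[1+ n ] R₃ ≈ - y
    R₃-odd n eq = trans (sym (-‿involutive _)) (-‿cong (trans (sym (branch-odd n (0<⇒≉0 0<R₃))) eq))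

  -- The point r₃ is shared by two intervals: as right end point of J_2 it is sent to R₃, as left
  -- end point of J_3 to itself.
  J∋±r₃ : ∀ s {m} → F m → J m (σ s r₃) →
          (m ≡ s ◃ 2 × branch m (σ s r₃) ≈ σ s R₃) ⊎ (m ≡ s ◃ 3 × branch m (σ s r₃) ≈ σ s r₃)
  J∋±r₃ Sign.+ m∈F ∈J with F⇒Digit m∈F
  ... | digit Sign.- k = contradiction (J⁺⇒<0 k ∈J) ¬-r₃<0
  ... | digit Sign.+ k with J⁺∋r₃ k ∈J
  ...   | inj₁ ≡.refl = inj₁ (≡.refl , trans (branch-r₃ 0) (x-0≈x R₃))
  ...   | inj₂ ≡.refl = inj₂ (≡.refl , trans (branch-r₃ 1) (+-congˡ (-‿cong (+-identityʳ 1#))))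
  J∋±r₃ Sign.- m∈F ∈J with F⇒Digit m∈F
  ... | digit Sign.+ k = contradiction (J⁺⇒<0 k ∈J) ¬-r₃<0
  ... | digit Sign.- k with J⁺∋r₃ k (J⁺-resp (2 ℕ.+ k) (-‿involutive r₃) ∈J)
  ...   | inj₁ ≡.refl = inj₁ (≡.refl , r₃-odd 1 (trans (branch-r₃ 0) (x-0≈x R₃)))
  ...   | inj₂ ≡.refl = inj₂ (≡.refl , r₃-odd 2 (trans (branch-r₃ 1) (+-congˡ (-‿cong (+-identityʳ 1#)))))

  J∋±R₃ : ∀ s {m} → F m → J m (σ s R₃) →
          m ≡ Sign.opposite s ◃ 2 × branch m (σ s R₃) ≈ σ (Sign.opposite s) r₃
  J∋±R₃ Sign.+ m∈F ∈J with F⇒Digit m∈F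
  ... | digit Sign.+ k = contradiction (J⁺⇒<0 k ∈J) (<-asym 0<R₃)
  ... | digit Sign.- k with ≡.refl ← J⁺∋-R₃ k ∈J =
        ≡.refl , R₃-odd 1 (trans (branch--R₃ 0) (x-0≈x r₃))
  J∋±R₃ Sign.- m∈F ∈J with F⇒Digit m∈F
  ... | digit Sign.- k = contradiction (<-respˡ-≈ (-‿involutive R₃) (J⁺⇒<0 k ∈J)) (<-asym 0<R₃)
  ... | digit Sign.+ k with ≡.refl ← J⁺∋-R₃ k ∈J =
        ≡.refl , trans (branch--R₃ 0) (x-0≈x r₃)

  𝔸≡1⇒≢ : ∀ {m n} → 𝔸 m n ≡ 1 → n ≢ sign m ◃ 2
  𝔸≡1⇒≢ {m} {n} 𝔸≡1 n≡ with n ℤ.≟ sign m ◃ 2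
  ... | yes _  = contradiction 𝔸≡1 λ ()
  ... | no n≢  = n≢ n≡

  ≢⇒𝔸≡1 : ∀ {m n} → n ≢ sign m ◃ 2 → 𝔸 m n ≡ 1
  ≢⇒𝔸≡1 {m} {n} n≢ with n ℤ.≟ sign m ◃ 2
  ... | yes n≡ = contradiction n≡ n≢
  ... | no _   = ≡.refl

  sign-◃ : ∀ s n → sign (s ◃ suc n) ≡ s
  sign-◃ Sign.+ n = ≡.refl
  sign-◃ Sign.- n = ≡.refl

  𝔸≡1⇒≢′ : ∀ s k {m n} → m ≡ s ◃ suc k → 𝔸 m n ≡ 1 → n ≢ s ◃ 2
  𝔸≡1⇒≢′ s k ≡.refl 𝔸≡1 = ≡.subst (λ t → _ ≢ t ◃ 2) (sign-◃ s k) (𝔸≡1⇒≢ 𝔸≡1)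

  -- Once the digit ±2 is excluded, only ±3 is left and the point stays fixed; admissibility after
  -- ±3 then excludes ±2 again.
  r₃-constant : ∀ s {ξ} → Admissible ξ → Path ξ (σ s r₃) → ξ 0 ≢ s ◃ 2 → ξ ≗ const (s ◃ 3)
  r₃-constant s adm@(ξ∈F , 𝔸≡1) path ξ₀≢ i with J∋±r₃ s (ξ∈F 0) (path 0)
  ... | inj₁ (ξ₀≡ , _)      = contradiction ξ₀≡ ξ₀≢
  ... | inj₂ (ξ₀≡ , fixed) with i
  ...   | zero  = ξ₀≡
  ...   | suc j = r₃-constant s (Admissible-tail adm) (Path-resp fixed (Path-tail path))
                    (𝔸≡1⇒≢′ s 2 ξ₀≡ (𝔸≡1 0)) j

  constant⇒EventuallyConstant : ∀ s {ξ} → ξ ≗ const (s ◃ 3) → EventuallyConstant±3 ξ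
  constant⇒EventuallyConstant Sign.+ ξ≗3  = 0 , inj₁ ξ≗3
  constant⇒EventuallyConstant Sign.- ξ≗-3 = 0 , inj₂ ξ≗-3

  EventuallyConstant-tail : ∀ {ξ} → EventuallyConstant±3 (τ ξ) → EventuallyConstant±3 ξ
  EventuallyConstant-tail {ξ} (n , τⁿτξ≗±3) =
    suc n , ≡.subst (λ η → η ≗ _ ⊎ η ≗ _) (fold-shift τ ξ n) τⁿτξ≗±3

  EventuallyConstant-τ^ : ∀ n {ξ} → EventuallyConstant±3 (τ^ n ξ) → EventuallyConstant±3 ξ
  EventuallyConstant-τ^ zero    ec = ec
  EventuallyConstant-τ^ (suc n) ec = EventuallyConstant-τ^ n (EventuallyConstant-tail ec)

  R₃⇒EventuallyConstant : ∀ s {ξ} → Admissible ξ → Path ξ (σ s R₃) → EventuallyConstant±3 ξ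
  R₃⇒EventuallyConstant s adm@(ξ∈F , 𝔸≡1) path with J∋±R₃ s (ξ∈F 0) (path 0)
  ... | ξ₀≡ , to-r₃ = EventuallyConstant-tail (constant⇒EventuallyConstant t
        (r₃-constant t (Admissible-tail adm) (Path-resp to-r₃ (Path-tail path)) (𝔸≡1⇒≢′ t 1 ξ₀≡ (𝔸≡1 0))))
    where t = Sign.opposite s

  -- There are two cases: r₃ has the expansion 3, 3, 3, ... and also 2, -2, -3, -3, ..., along r₃,
  -- R₃, -r₃, -r₃, .... Hence the point map is not injective on all admissible sequences.
  r₃⇒EventuallyConstant : ∀ s {ξ} → Admissible ξ → Path ξ (σ s r₃) → EventuallyConstant±3 ξ
  r₃⇒EventuallyConstant s {ξ} adm@(ξ∈F , _) path with J∋±r₃ s (ξ∈F 0) (path 0)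
  ... | inj₁ (_ , to-R₃)   = EventuallyConstant-tail
        (R₃⇒EventuallyConstant s (Admissible-tail adm) (Path-resp to-R₃ (Path-tail path)))
  ... | inj₂ (ξ₀≡ , _)     = constant⇒EventuallyConstant s
        (r₃-constant s adm path (λ ξ₀≡2 → 3≢2 s (≡.trans (≡.sym ξ₀≡) ξ₀≡2)))
    where
    3≢2 : ∀ s → s ◃ 3 ≢ s ◃ 2
    3≢2 Sign.+ ()
    3≢2 Sign.- ()

  r₃-fixed : ∀ s → branch (s ◃ 3) (σ s r₃) ≈ σ s r₃
  r₃-fixed Sign.+ = trans (branch-r₃ 1) (+-congˡ (-‿cong (+-identityʳ 1#)))
  r₃-fixed Sign.- = r₃-odd 2 (r₃-fixed Sign.+)

  r₃∈J₃ : ∀ s → J (s ◃ 3) (σ s r₃)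
  r₃∈J₃ Sign.+ = Window⇒J⁺ 1 r₃<0 (Window-resp (sym (r₃-fixed Sign.+)) (inj₂ refl , r₃≤R₃))
  r₃∈J₃ Sign.- = J⁺-resp 3 (sym (-‿involutive r₃)) (r₃∈J₃ Sign.+)

  constant-Path : ∀ s → Path (const (s ◃ 3)) (σ s r₃)
  constant-Path s l = J-resp (s ◃ 3) (sym (branches-fixed l)) (r₃∈J₃ s)
    where
    branches-fixed : ∀ l → branches (const (s ◃ 3)) l (σ s r₃) ≈ σ s r₃
    branches-fixed zero    = refl
    branches-fixed (suc l) = trans (branch-cong (s ◃ 3) (branches-fixed l)) (r₃-fixed s)

-- Rounding as a choice of digit.

module Coding (ℝ : CompleteOrderedField) where
  open RosenMap ℝ
  open IsStrictTotalOrder isStrictTotalOrder using (_≟_)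
  open Arithmetic ℝ
  open Inverses ℝ
  open GoldenRatio ℝ
  open Branches ℝ
  open Expansions ℝ
  open Boundary ℝ
  open RingProperties ring

  signed : Sign → ℤ → ℤ
  signed Sign.+ n = n
  signed Sign.- n = ℤ.- n

  -- Half-open, unlike the closed J m: this is where ⟨_⟩⋆ breaks ties.
  Nearest : ℤ → Carrier → Set
  Nearest n x = ι n + r₃ ≤ x × x < ι n + R₃

  ⟨⟩⋆-nearest : ∀ s {x} → 0# < σ s x → ∃[ n ] ⟨ x ⟩⋆ ≡ signed s n × Nearest n (σ s x)
  ⟨⟩⋆-nearest Sign.+ {x} 0<x with compare x 0#
  ... | tri< x<0 _ _ = contradiction 0<x (<-asym x<0)
  ... | tri≈ _ x≈0 _ = contradiction 0<x (<-irrefl (sym x≈0))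
  ... | tri> _ _ 0<x = _ , ≡.refl , proj₂ (nearest x (inj₁ 0<x))
  ⟨⟩⋆-nearest Sign.- {x} 0<-x with compare x 0#
  ... | tri< x<0 _ _ = _ , ≡.refl , proj₂ (nearest (- x) (inj₁ (x<0⇒0<-x x<0)))
  ... | tri≈ _ x≈0 _ = contradiction x≈0 (λ x≈0 → 0<⇒≉0 0<-x (trans (-‿cong x≈0) -0#≈0#))
  ... | tri> _ _ 0<x = contradiction 0<-x (<-asym (0<⇒-<0 0<x))

  -- The integer that `f⋆` subtracts at z ≉ 0. A code digit thus depends on the orbit point alone,
  -- and commuting with the shift is a mere reindexing of the orbit.
  code-digit : Carrier → ℤ
  code-digit z = ⟨ - z ⁻¹ ⟩⋆

  ≉0⇒sign : ∀ {z} → ¬ z ≈ 0# → ∃[ s ] σ s z < 0#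
  ≉0⇒sign {z} z≉0 with compare z 0#
  ... | tri< z<0 _ _ = Sign.+ , z<0
  ... | tri≈ _ z≈0 _ = contradiction z≈0 z≉0
  ... | tri> _ _ 0<z = Sign.- , 0<⇒-<0 0<z

  σ--⁻¹ : ∀ s {z} → ¬ z ≈ 0# → σ s (- z ⁻¹) ≈ (- σ s z) ⁻¹
  σ--⁻¹ Sign.+ z≉0 = sym (⁻¹-neg z≉0)
  σ--⁻¹ Sign.- z≉0 = trans (-‿involutive _) (⁻¹-cong (sym (-‿involutive _)))

  σ-branch : ∀ s n z → σ s (branch (s ◃ suc n) z) ≈ σ s (- z ⁻¹) - ι (+ suc n)
  σ-branch Sign.+ n z = refl
  σ-branch Sign.- n z = solve 2 (λ a b → :- (a :- :- b) := :- a :- b) refl (- z ⁻¹) (ι (+ suc n))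

  module _ {s z} (σz<0 : σ s z < 0#) where
    private
      p : Carrier
      p = σ s (- z ⁻¹)

      p≈ : p ≈ (- σ s z) ⁻¹
      p≈ = σ--⁻¹ s (σ-≉0 s σz<0)

    0<σ-⁻¹ : 0# < p
    0<σ-⁻¹ = <-respʳ-≈ (sym p≈) (⁻¹-pos (x<0⇒0<-x σz<0))

    R₃+1≤σ-⁻¹ : I z → R₃ + 1# ≤ p
    R₃+1≤σ-⁻¹ z∈I = ≤-resp R₃⁻¹≈R₃+1 (sym p≈) (⁻¹-anti-≤ (x<0⇒0<-x σz<0) (bound s z∈I))
      where
      bound : ∀ s {z} → I z → - σ s z ≤ R₃
      bound Sign.+ z∈I = proj₂ (I-neg z∈I)
      bound Sign.- z∈I = ≤-resp (sym (-‿involutive _)) refl (proj₂ z∈I)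

    -- Why the digits 0 and ±1 never occur: here `p` is 1/|z|, and R₃ + 1 ≤ p < n + R₃ forces n > 1.
    nearest⇒≥2 : ∀ {n} → I z → Nearest n p → ∃[ k ] n ≡ + (2 ℕ.+ k)
    nearest⇒≥2 {n} z∈I (_ , p<n+R₃) = extract 1<n
      where
      R₃+1<n+R₃ : R₃ + 1# < ι n + R₃
      R₃+1<n+R₃ = ≤-<-trans (R₃+1≤σ-⁻¹ z∈I) p<n+R₃
      1<ιn : 1# < ι n
      1<ιn = <-by-difference (solve 2 (λ R n → n :+ R :- (R :+ con (+ 1)) := n :- con (+ 1)) refl R₃ (ι n)) R₃+1<n+R₃
      1<n : + 1 ℤ.< n
      1<n with ℤ.<-cmp (+ 1) n
      ... | tri< 1<n _ _      = 1<n
      ... | tri≈ _ ≡.refl _   = contradiction 1<ιn (<-irrefl (sym (+-identityʳ 1#)))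
      ... | tri> _ _ n<1      = contradiction 1<ιn (<-asym (<-≤-trans
              (<-respˡ-≈ (+-identityʳ (ι n)) (+-monoʳ-< (ι n) 0<1))
              (≤-resp refl (+-identityʳ 1#) (ι-gap n<1))))
      extract : ∀ {n} → + 1 ℤ.< n → ∃[ k ] n ≡ + (2 ℕ.+ k)
      extract (ℤ.+<+ (ℕ.s≤s (ℕ.s≤s {n = k} _))) = k , ≡.refl

    nearest⇒digit : ∀ {k} → Nearest (+ (2 ℕ.+ k)) p → code-digit z ≡ s ◃ (2 ℕ.+ k)
    nearest⇒digit {k} near-k = ≡.trans ⟨⟩≡n (≡.trans (≡.cong (signed s) (nearest-unique near-n near-k)) (signed-◃ s))
      where
      spec : ∃[ n ] code-digit z ≡ signed s n × Nearest n p
      spec = ⟨⟩⋆-nearest s 0<σ-⁻¹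
      ⟨⟩≡n = proj₁ (proj₂ spec)
      near-n = proj₂ (proj₂ spec)
      signed-◃ : ∀ s → signed s (+ (2 ℕ.+ k)) ≡ s ◃ (2 ℕ.+ k)
      signed-◃ Sign.+ = ≡.refl
      signed-◃ Sign.- = ≡.refl

    digit-exists : I z → ∃[ k ] code-digit z ≡ s ◃ (2 ℕ.+ k) × Nearest (+ (2 ℕ.+ k)) p
    digit-exists z∈I =
      let n , _ , near-n = ⟨⟩⋆-nearest s 0<σ-⁻¹
          k , n≡         = nearest⇒≥2 {n} z∈I near-n
          near-k         = ≡.subst (λ n → Nearest n p) n≡ near-n
      in k , nearest⇒digit near-k , near-k

  Nearest⇒Window : ∀ s k {z} → Nearest (+ (2 ℕ.+ k)) (σ s (- z ⁻¹)) →
                   Window (σ s (branch (s ◃ (2 ℕ.+ k)) z))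
  Nearest⇒Window s k {z} (l , u) = Window-resp (sym (σ-branch s (suc k) z))
    ( ≤-by-difference (solve 3 (λ p K r → p :- (K :+ r) := p :- K :- r) refl _ (K k) r₃) l
    , ≤-by-difference (solve 3 (λ p K R → K :+ R :- p := R :- (p :- K)) refl _ (K k) R₃) (inj₁ u))

  code-digit∈F : ∀ {z} → I z → ¬ z ≈ 0# → F (code-digit z)
  code-digit∈F z∈I z≉0 =
    let s , σz<0      = ≉0⇒sign z≉0
        k , digit≡ , _ = digit-exists {s} σz<0 z∈I
    in ≡.subst F (≡.sym digit≡) (Digit⇒F s k)

  J-code-digit : ∀ {z} → I z → ¬ z ≈ 0# → J (code-digit z) z
  J-code-digit {z} z∈I z≉0 =
    let s , σz<0            = ≉0⇒sign z≉0
        k , digit≡ , near-k = digit-exists {s} σz<0 z∈I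
    in ≡.subst (λ m → J m z) (≡.sym digit≡) (Image⇒J (Digit⇒F s k)
         (≡.subst (λ t → σ t z < 0#) (≡.sym (sign-◃ s (suc k))) σz<0)
         (≡.subst (λ t → Window (σ t (branch (s ◃ (2 ℕ.+ k)) z))) (≡.sym (sign-◃ s (suc k)))
           (Nearest⇒Window s k near-k)))

  f⋆-branch : ∀ (x : ∃ I) → ¬ proj₁ x ≈ 0# →
              proj₁ (f⋆ x) ≡ branch (code-digit (proj₁ x)) (proj₁ x)
  f⋆-branch (z , _) z≉0 with z ≟ 0#
  ... | yes z≈0 = contradiction z≈0 z≉0
  ... | no _    = ≡.refl

  private
    -- The closed window exceeds the rounding interval only by its upper end. There p - (2 + k) =
    -- R₃, rounding moves on to 3 + k, and the remainder becomes R₃ - 1 = r₃.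
    digit-ambiguity : ∀ s k {z} → σ s z < 0# →
                      Window (σ s (branch (s ◃ (2 ℕ.+ k)) z)) →
                      code-digit z ≡ s ◃ (2 ℕ.+ k) ⊎
                      (branch (s ◃ (2 ℕ.+ k)) z ≈ σ s R₃ × branch (code-digit z) z ≈ σ s r₃)
    digit-ambiguity s k {z} σz<0 w = cases w′
      where
      p : Carrier
      p = σ s (- z ⁻¹)
      w′ : Window (p - K k)
      w′ = Window-resp (σ-branch s (suc k) z) w
      lower : K k + r₃ ≤ p
      lower = ≤-by-difference (solve 3 (λ p K r → p :- K :- r := p :- (K :+ r)) refl p (K k) r₃) (proj₁ w′)
      unsign : ∀ {x y} → σ s x ≈ y → x ≈ σ s y
      unsign eq = trans (sym (σ-involutive s _)) (σ-cong s eq)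
      cases : Window (p - K k) → _
      cases (_ , inj₁ p-K<R₃) = inj₁ (nearest⇒digit {s} σz<0 (lower ,
        <-by-difference (solve 3 (λ p K R → R :- (p :- K) := K :+ R :- p) refl p (K k) R₃) p-K<R₃))
      cases (_ , inj₂ p-K≈R₃) = inj₂
        ( unsign (trans (σ-branch s (suc k) z) p-K≈R₃)
        , trans (reflexive (≡.cong (λ m → branch m z) (nearest⇒digit {s} σz<0 near-next)))
                (unsign (trans (σ-branch s (2 ℕ.+ k) z) p-K-1≈r₃)))
        where
        p-K-1≈r₃ : p - K (suc k) ≈ r₃
        p-K-1≈r₃ = trans
          (solve 2 (λ p x → p :- (con (+ 1) :+ x) := p :- x :- con (+ 1)) refl p (K k))
          (+-congʳ p-K≈R₃)
        p≈ : K (suc k) + r₃ ≈ p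
        p≈ = trans (+-congˡ (sym p-K-1≈r₃))
          (solve 2 (λ p x → x :+ (p :- x) := p) refl p (K (suc k)))
        -- The tie sits exactly on the included lower end of the next rounding interval.
        near-next : Nearest (+ (3 ℕ.+ k)) p
        near-next = inj₂ p≈ , <-respˡ-≈ p≈ (+-monoʳ-< (K (suc k)) r₃<R₃)
          where
          r₃<R₃ : r₃ < R₃
          r₃<R₃ = <-trans r₃<0 0<R₃

  J⇒code-digit : ∀ {m z} → F m → J m z → code-digit z ≡ m ⊎
                 ∃[ s ] branch m z ≈ σ s R₃ × branch (code-digit z) z ≈ σ s r₃
  J⇒code-digit m∈F z∈J with F⇒Digit m∈F
  ... | digit Sign.+ k = map₂ (Sign.+ ,_) (digit-ambiguity Sign.+ k (J⇒<0 m∈F z∈J) (J⇒Image m∈F z∈J))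
  ... | digit Sign.- k = map₂ (Sign.- ,_) (digit-ambiguity Sign.- k (J⇒<0 m∈F z∈J) (J⇒Image m∈F z∈J))

  f⋆-step : ∀ {m} (x : ∃ I) → F m → J m (proj₁ x) →
            (code-digit (proj₁ x) ≡ m × proj₁ (f⋆ x) ≡ branch m (proj₁ x)) ⊎
            ∃[ s ] branch m (proj₁ x) ≈ σ s R₃ × proj₁ (f⋆ x) ≈ σ s r₃
  f⋆-step x@(z , _) m∈F z∈J with J⇒code-digit m∈F z∈J
  ... | inj₁ digit≡m      = inj₁ (digit≡m ,
        ≡.trans (f⋆-branch x (J⇒≉0 m∈F z∈J)) (≡.cong (λ m → branch m z) digit≡m))
  ... | inj₂ (s , R , r)  = inj₂ (s , R , trans (reflexive (f⋆-branch x (J⇒≉0 m∈F z∈J))) r)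

  -- Orbits, code sequences and the inverse coding.

  orbit : ∃ I → ℕ → Carrier
  orbit x i = proj₁ (f⋆^ i x)

  orbit∈I : ∀ x i → I (orbit x i)
  orbit∈I x i = proj₂ (f⋆^ i x)

  module _ (x : ∃ I) (x∉∂ℳ : ¬ ∂ℳ x) where
    orbit≉0 : ∀ i → ¬ orbit x i ≈ 0#
    orbit≉0 i z≈0 = x∉∂ℳ (i , inj₂ z≈0)

    orbit≉±r₃ : ∀ i s → ¬ orbit x i ≈ σ s r₃
    orbit≉±r₃ i Sign.+ z≈r₃  = x∉∂ℳ (i , inj₁ (inj₁ z≈r₃))
    orbit≉±r₃ i Sign.- z≈-r₃ = x∉∂ℳ (i , inj₁ (inj₂ z≈-r₃))

  codeSequence : ∃ I → ℕ → ℤ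
  codeSequence x i = code-digit (orbit x i)

  module _ (x : ∃ I) (x∉∂ℳ : ¬ ∂ℳ x) where
    private
      ξ : ℕ → ℤ
      ξ = codeSequence x

    codeSequence∈F : ∀ i → F (ξ i)
    codeSequence∈F i = code-digit∈F (orbit∈I x i) (orbit≉0 x x∉∂ℳ i)

    codeSequence-itinerary : Itinerary x ξ
    codeSequence-itinerary i = J-code-digit (orbit∈I x i) (orbit≉0 x x∉∂ℳ i)

    orbit≡branches : ∀ i → orbit x i ≡ branches ξ i (proj₁ x)
    orbit≡branches zero    = ≡.refl
    orbit≡branches (suc i) = ≡.trans (f⋆-branch (f⋆^ i x) (orbit≉0 x x∉∂ℳ i))
                               (≡.cong (branch (ξ i)) (orbit≡branches i))

    codeSequence-Path : Path ξ (proj₁ x)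
    codeSequence-Path i = ≡.subst (J (ξ i)) (orbit≡branches i) (codeSequence-itinerary i)

    -- A forbidden digit would put the next orbit point, up to sign, into J_2 and hence at most r₃,
    -- while the image of the previous branch keeps it at least r₃. It would be ±r₃, which `∂ℳ`
    -- excludes.
    codeSequence-admissible : Admissible ξ
    codeSequence-admissible = codeSequence∈F , λ i → ≢⇒𝔸≡1 λ next≡2 →
      orbit≉±r₃ x x∉∂ℳ (suc i) (sign (ξ i)) (≈r₃ (sign (ξ i))
        (≡.subst (λ m → J m (orbit x (suc i))) next≡2 (codeSequence-itinerary (suc i)))
        (≡.subst (Image (ξ i)) (≡.sym (f⋆-branch (f⋆^ i x) (orbit≉0 x x∉∂ℳ i)))
          (J⇒Image (codeSequence∈F i) (codeSequence-itinerary i))))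
      where
      ≈r₃ : ∀ s {z} → J (s ◃ 2) z → Window (σ s z) → z ≈ σ s r₃
      ≈r₃ Sign.+ z∈J (r₃≤z , _)  = ≤-antisym (J⁺₂⇒≤r₃ z∈J) r₃≤z
      ≈r₃ Sign.- z∈J (r₃≤-z , _) = trans (sym (-‿involutive _))
                                     (-‿cong (≤-antisym (J⁺₂⇒≤r₃ z∈J) r₃≤-z))

    codeSequence-unique : ∀ {η} → (∀ i → F (η i)) → Itinerary x η → η ≗ ξ
    codeSequence-unique η∈F x-η i with f⋆-step (f⋆^ i x) (η∈F i) (x-η i)
    ... | inj₁ (digit≡ , _)   = ≡.sym digit≡
    ... | inj₂ (s , _ , hits) = contradiction hits (orbit≉±r₃ x x∉∂ℳ (suc i) s)

    -- Constant ±3 is an expansion of ±r₃, so by uniqueness the n-th orbit point would be ±r₃.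
    codeSequence-tail≢ : ∀ n s → ¬ τ^ n ξ ≗ const (s ◃ 3)
    codeSequence-tail≢ n s τⁿξ≗ = orbit≉±r₃ x x∉∂ℳ n s (trans (reflexive (orbit≡branches n))
      (Path-unique (λ _ → Digit⇒F s 1) (Path-ext τⁿξ≗ (Path-τ^ n codeSequence-Path)) (constant-Path s)))

    codeSequence-¬EventuallyConstant : ¬ EventuallyConstant±3 ξ
    codeSequence-¬EventuallyConstant (n , inj₁ τⁿξ≗3)  = codeSequence-tail≢ n Sign.+ τⁿξ≗3
    codeSequence-¬EventuallyConstant (n , inj₂ τⁿξ≗-3) = codeSequence-tail≢ n Sign.- τⁿξ≗-3

  module _ {ξ} (adm : Admissible ξ) (ξ∉ : ¬ EventuallyConstant±3 ξ) (x : ∃ I) (path : Path ξ (proj₁ x)) where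
    private
      w : ℕ → Carrier
      w i = branches ξ i (proj₁ x)

    branches≉±R₃ : ∀ i s → ¬ w i ≈ σ s R₃
    branches≉±R₃ i s wᵢ≈R₃ = ξ∉ (EventuallyConstant-τ^ i
      (R₃⇒EventuallyConstant s (Admissible-τ^ i adm) (Path-resp wᵢ≈R₃ (Path-τ^ i path))))

    branches≉±r₃ : ∀ i s → ¬ w i ≈ σ s r₃
    branches≉±r₃ i s wᵢ≈r₃ = ξ∉ (EventuallyConstant-τ^ i
      (r₃⇒EventuallyConstant s (Admissible-τ^ i adm) (Path-resp wᵢ≈r₃ (Path-τ^ i path))))

    -- As long as the two orbits agree, the next step can separate them only at a tie, and then
    -- `w (suc i)` would be ±R₃.
    orbit≈branches : ∀ i → orbit x i ≈ w i
    orbit≈branches zero    = refl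
    orbit≈branches (suc i) with f⋆-step (f⋆^ i x) (proj₁ adm i) (J-resp (ξ i) (sym (orbit≈branches i)) (path i))
    ... | inj₁ (_ , step)     = trans (reflexive step) (branch-cong (ξ i) (orbit≈branches i))
    ... | inj₂ (s , hits , _) = contradiction
            (trans (branch-cong (ξ i) (sym (orbit≈branches i))) hits) (branches≉±R₃ (suc i) s)

    Path⇒Itinerary : Itinerary x ξ
    Path⇒Itinerary i = J-resp (ξ i) (sym (orbit≈branches i)) (path i)

    Path⇒∉∂ℳ : ¬ ∂ℳ x
    Path⇒∉∂ℳ (n , inj₁ (inj₁ z≈r₃))  = branches≉±r₃ n Sign.+ (trans (sym (orbit≈branches n)) z≈r₃)
    Path⇒∉∂ℳ (n , inj₁ (inj₂ z≈-r₃)) = branches≉±r₃ n Sign.- (trans (sym (orbit≈branches n)) z≈-r₃)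
    Path⇒∉∂ℳ (n , inj₂ z≈0)          =
      J⇒≉0 (proj₁ adm n) (path n) (trans (sym (orbit≈branches n)) z≈0)

  point : ∃ Admissible → ∃ I
  point (ξ , adm) = let x , path = Path-exists adm in x , J⇒I (proj₁ adm 0) (path 0)

  point-Path : ∀ ((ξ , adm) : ∃ Admissible) → Path ξ (proj₁ (point (ξ , adm)))
  point-Path (ξ , adm) = proj₂ (Path-exists adm)

  point-unique : ∀ (ξ : ∃ Admissible) {y} → Path (proj₁ ξ) y → y ≈ proj₁ (point ξ)
  point-unique ξ path = Path-unique (proj₁ (proj₂ ξ)) path (point-Path ξ)

  code : Setoid.Carrier 𝕀∖∂ℳ → Setoid.Carrier F_𝔸∖±3
  code (x , x∉) = (codeSequence x , codeSequence-admissible x x∉) , codeSequence-¬EventuallyConstant x x∉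

  -- Together with `code-sound` this characterises the code of x as the sequence that x follows.
  -- Congruence and surjectivity of the coding then come from transporting a `Path`, and injectivity
  -- from uniqueness of its point.
  code-complete : ∀ x (ξ : Setoid.Carrier F_𝔸∖±3) →
                  Path (proj₁ (proj₁ ξ)) (proj₁ (proj₁ x)) → Setoid._≈_ F_𝔸∖±3 (code x) ξ
  code-complete (x , x∉) ((ξ , adm) , ξ∉) path i =
    ≡.sym (codeSequence-unique x x∉ (proj₁ adm) (Path⇒Itinerary adm ξ∉ x path) i)

  code-sound : ∀ x (ξ : Setoid.Carrier F_𝔸∖±3) →
               Setoid._≈_ F_𝔸∖±3 (code x) ξ → Path (proj₁ (proj₁ ξ)) (proj₁ (proj₁ x))
  code-sound (x , x∉) ξ code≗ξ = Path-ext code≗ξ (codeSequence-Path x x∉)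

  code-cong : ∀ {x y} → Setoid._≈_ 𝕀∖∂ℳ x y → Setoid._≈_ F_𝔸∖±3 (code x) (code y)
  code-cong {x} {y} x≈y = code-complete x (code y) (Path-resp (sym x≈y) (code-sound y (code y) λ _ → ≡.refl))

  code-bijection : Bijection 𝕀∖∂ℳ F_𝔸∖±3
  code-bijection = record
    { to        = code
    ; cong      = λ {x} {y} → code-cong {x} {y}
    ; bijective = (λ {x} {y} → injective {x} {y}) , surjective
    }
    where
    injective : ∀ {x y} → Setoid._≈_ F_𝔸∖±3 (code x) (code y) → Setoid._≈_ 𝕀∖∂ℳ x y
    injective {x} {y} code≗ = Path-unique (proj₁ (proj₂ (proj₁ (code y))))
      (code-sound x (code y) code≗) (code-sound y (code y) λ _ → ≡.refl)

    surjective : ∀ ξ → ∃[ x ] ∀ {y} → Setoid._≈_ 𝕀∖∂ℳ y x → Setoid._≈_ F_𝔸∖±3 (code y) ξ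
    surjective ξ@(ξ₀@(_ , adm) , ξ∉) =
        (point ξ₀ , Path⇒∉∂ℳ adm ξ∉ (point ξ₀) (point-Path ξ₀))
      , λ {y} y≈x → code-complete y ξ (Path-resp (sym y≈x) (point-Path ξ₀))

  point-func : Func F_𝔸 𝕀
  point-func = record
    { to   = point
    ; cong = λ {ξ} {η} ξ≗η → point-unique η (Path-ext ξ≗η (point-Path ξ))
    }

-- The point map has a larger domain than the image of the coding, so the last clause expresses that
-- it extends the inverse by an equivalence between having code ξ and being the point of ξ.
lemma4p3p1 : (ℝ : CompleteOrderedField) → let open RosenMap ℝ in
    Σ[ π ∈ Bijection 𝕀∖∂ℳ F_𝔸∖±3 ] Σ[ π⁻¹ ∈ Func F_𝔸 𝕀 ]
      (let open Bijection π renaming (to to code)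
           open Func π⁻¹ renaming (to to point) in
        (∀ x → Itinerary (proj₁ x) (proj₁ (proj₁ (code x))))
      × (∀ x (ξ : ℕ → ℤ) → (∀ i → F (ξ i)) → Itinerary (proj₁ x) ξ →
           ξ ≗ proj₁ (proj₁ (code x)))
      × (∀ x → Setoid._≈_ F_𝔸∖±3 (code (f⋆-restricted x)) (τ-restricted (code x)))
      × (∀ ξ → Nested (proj₁ ξ) (point ξ))
      × (∀ ξ y → Nested (proj₁ ξ) y → Setoid._≈_ 𝕀 y (point ξ))
      × (∀ x ξ → Setoid._≈_ F_𝔸∖±3 (code x) ξ ⇔ Setoid._≈_ 𝕀 (point (proj₁ ξ)) (proj₁ x)))
lemma4p3p1 ℝ =
    code-bijection
  , point-func
  , (λ (x , x∉) → codeSequence-itinerary x x∉)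
  , (λ (x , x∉) ξ ξ∈F → codeSequence-unique x x∉ ξ∈F)
  , (λ (x , _) i → ≡.cong (code-digit ∘ proj₁) (fold-shift f⋆ x i))
  , point-Path
  , (λ ξ _ → point-unique ξ)
  , (λ x ξ → mk⇔ (λ code≗ξ → sym (point-unique (proj₁ ξ) (code-sound x ξ code≗ξ)))
                 (λ point≈x → code-complete x ξ (Path-resp point≈x (point-Path (proj₁ ξ)))))
  where
  open RosenMap ℝ
  open Expansions ℝ
  open Coding ℝ
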